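{- Let $(\mathcal{E},\mathcal{S})$ be a predicative category with small maps satisfying the fullness axiom $\mathbf{(F)}$, and let $\mathcal{C}$ be an internal category in $\mathcal{E}$ with small codomain map and with chosen pullbacks. Then the category $\mathrm{Psh}_{\mathcal{E}}(\mathcal{C})$ of internal presheaves with the pointwise small maps satisfies $\mathbf{(F)}$.
   Context: $(\mathcal{E},\mathcal{S})$ is a predicative category with small maps: a positive Heyting category with a class of small maps (pullback stability, descent, sums, finiteness, composition, quotients along covers, collection, Heyting and diagonal axioms), exponentiable small maps, W-types, a small natural numbers object, a universal small map, and bounded exactness. Internal presheaves: objects of $\mathcal{E}/\mathcal{C}_0$ with a right $\mathcal{C}$-action; pointwise small maps: those whose underlying map in $\mathcal{E}/\mathcal{C}_0$ is small; covers are pointwise covers. Fullness (F), stated for a category with small maps: given a small $\phi:B\to A$ over $X$ with $A\to X$ small, an mvs of $\phi$ over a map $Y\to X$ is a subobject $P\subseteq Y\times_XB$ such that $P\to Y\times_XA$ is a small cover; mvss pull back along maps and are ordered by inclusion. (F) says: for every such $\phi$ there are a cover $q:X'\to X$, a small map $y:Y\to X'$ and an mvs $P$ of $\phi$ over $Y$ such that for any $z:Z\to X'$ and any mvs $Q$ of $\phi$ over $Z$ there are $k:U\to Y$ and a cover $l:U\to Z$ with $yk=zl$ and $k^*P\le l^*Q$. -}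

module Defs where

open import Level using (Level; _⊔_; suc)
open import Data.Product using (Σ-syntax; _×_)
open import Function.Bundles using (_⇔_)
open import Relation.Binary.Bundles using (Setoid)
open import Relation.Binary.Structures using (IsEquivalence)
import Relation.Binary.Reasoning.Setoid as SetoidReasoning

-- Categories enriched in setoids.  Throughout, "there is" is read as a Σ-type,
-- so limits, images, adjoints, ... are given by chosen data.

record Category (o ℓ e : Level) : Set (suc (o ⊔ ℓ ⊔ e)) where
  infix  4 _≈_ _⇒_
  infixr 9 _∘_
  field
    Obj       : Set o
    _⇒_       : Obj → Obj → Set ℓ
    _≈_       : ∀ {A B} → A ⇒ B → A ⇒ B → Set e
    id        : ∀ {A} → A ⇒ A
    _∘_       : ∀ {A B C} → B ⇒ C → A ⇒ B → A ⇒ C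
    assoc     : ∀ {A B C D} (h : C ⇒ D) (g : B ⇒ C) (f : A ⇒ B) →
                (h ∘ g) ∘ f ≈ h ∘ (g ∘ f)
    identityˡ : ∀ {A B} (f : A ⇒ B) → id ∘ f ≈ f
    identityʳ : ∀ {A B} (f : A ⇒ B) → f ∘ id ≈ f
    equiv     : ∀ {A B} → IsEquivalence (_≈_ {A} {B})
    ∘-cong    : ∀ {A B C} {g g′ : B ⇒ C} {f f′ : A ⇒ B} →
                g ≈ g′ → f ≈ f′ → g ∘ f ≈ g′ ∘ f′

  module Eq {A B : Obj} = IsEquivalence (equiv {A} {B})

  homSetoid : Obj → Obj → Setoid ℓ e
  homSetoid A B = record { Carrier = A ⇒ B ; _≈_ = _≈_ ; isEquivalence = equiv }

  module HomReasoning {A B : Obj} = SetoidReasoning (homSetoid A B)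

  ∘-congˡ : ∀ {A B C} {g : B ⇒ C} {f f′ : A ⇒ B} → f ≈ f′ → g ∘ f ≈ g ∘ f′
  ∘-congˡ = ∘-cong Eq.refl

  ∘-congʳ : ∀ {A B C} {g g′ : B ⇒ C} {f : A ⇒ B} → g ≈ g′ → g ∘ f ≈ g′ ∘ f
  ∘-congʳ p = ∘-cong p Eq.refl

------------------------------------------------------------------------

module Morphisms {o ℓ e} (𝓒 : Category o ℓ e) where
  open Category 𝓒

  Mono : ∀ {A B} → A ⇒ B → Set (o ⊔ ℓ ⊔ e)
  Mono {A} m = ∀ {Z} (u v : Z ⇒ A) → m ∘ u ≈ m ∘ v → u ≈ v

  record IsIso {A B} (f : A ⇒ B) : Set (ℓ ⊔ e) where
    field
      inv  : B ⇒ A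
      invˡ : inv ∘ f ≈ id
      invʳ : f ∘ inv ≈ id

  Cover : ∀ {A B} → A ⇒ B → Set (o ⊔ ℓ ⊔ e)
  Cover {A} {B} f =
    ∀ {M} (m : M ⇒ B) (g : A ⇒ M) → Mono m → m ∘ g ≈ f → IsIso m

  record IsTerminal (T : Obj) : Set (o ⊔ ℓ ⊔ e) where
    field
      !        : ∀ {A} → A ⇒ T
      !-unique : ∀ {A} (u v : A ⇒ T) → u ≈ v

  record IsInitial (I : Obj) : Set (o ⊔ ℓ ⊔ e) where
    field
      ¡        : ∀ {A} → I ⇒ A
      ¡-unique : ∀ {A} (u v : I ⇒ A) → u ≈ v

  record IsCoproduct {A B S} (i₁ : A ⇒ S) (i₂ : B ⇒ S) : Set (o ⊔ ℓ ⊔ e) where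
    field
      [_,_]  : ∀ {Z} → A ⇒ Z → B ⇒ Z → S ⇒ Z
      inj₁   : ∀ {Z} (f : A ⇒ Z) (g : B ⇒ Z) → [ f , g ] ∘ i₁ ≈ f
      inj₂   : ∀ {Z} (f : A ⇒ Z) (g : B ⇒ Z) → [ f , g ] ∘ i₂ ≈ g
      unique : ∀ {Z} (u v : S ⇒ Z) → u ∘ i₁ ≈ v ∘ i₁ → u ∘ i₂ ≈ v ∘ i₂ → u ≈ v

  record Coproduct (A B : Obj) : Set (o ⊔ ℓ ⊔ e) where
    field
      {obj}       : Obj
      i₁          : A ⇒ obj
      i₂          : B ⇒ obj
      isCoproduct : IsCoproduct i₁ i₂
    open IsCoproduct isCoproduct public

  record IsCoequalizer {R X Q} (r₁ r₂ : R ⇒ X) (q : X ⇒ Q) : Set (o ⊔ ℓ ⊔ e) where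
    field
      commute   : q ∘ r₁ ≈ q ∘ r₂
      factor    : ∀ {Z} (f : X ⇒ Z) → f ∘ r₁ ≈ f ∘ r₂ → Q ⇒ Z
      factor-∘  : ∀ {Z} (f : X ⇒ Z) (p : f ∘ r₁ ≈ f ∘ r₂) → factor f p ∘ q ≈ f
      unique    : ∀ {Z} (u v : Q ⇒ Z) → u ∘ q ≈ v ∘ q → u ≈ v

  record IsPullback {P A B X} (p₁ : P ⇒ A) (p₂ : P ⇒ B) (f : A ⇒ X) (g : B ⇒ X) :
                    Set (o ⊔ ℓ ⊔ e) where
    field
      commute   : f ∘ p₁ ≈ g ∘ p₂
      universal : ∀ {Z} (a : Z ⇒ A) (b : Z ⇒ B) → f ∘ a ≈ g ∘ b → Z ⇒ P
      proj₁-∘   : ∀ {Z} (a : Z ⇒ A) (b : Z ⇒ B) (c : f ∘ a ≈ g ∘ b) →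
                  p₁ ∘ universal a b c ≈ a
      proj₂-∘   : ∀ {Z} (a : Z ⇒ A) (b : Z ⇒ B) (c : f ∘ a ≈ g ∘ b) →
                  p₂ ∘ universal a b c ≈ b
      unique    : ∀ {Z} (u v : Z ⇒ P) → p₁ ∘ u ≈ p₁ ∘ v → p₂ ∘ u ≈ p₂ ∘ v → u ≈ v

  record Pullback {A B X} (f : A ⇒ X) (g : B ⇒ X) : Set (o ⊔ ℓ ⊔ e) where
    field
      {P}        : Obj
      p₁         : P ⇒ A
      p₂         : P ⇒ B
      isPullback : IsPullback p₁ p₂ f g
    open IsPullback isPullback public

  record Subobject (X : Obj) : Set (o ⊔ ℓ ⊔ e) where
    field
      {dom} : Obj
      arr   : dom ⇒ X
      mono  : Mono arr

  infix 4 _≤_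
  _≤_ : ∀ {X} → Subobject X → Subobject X → Set (ℓ ⊔ e)
  S ≤ T = Σ[ h ∈ Subobject.dom S ⇒ Subobject.dom T ]
            Subobject.arr T ∘ h ≈ Subobject.arr S

HasPullbacks : ∀ {o ℓ e} → Category o ℓ e → Set (o ⊔ ℓ ⊔ e)
HasPullbacks 𝓒 = ∀ {A B X} (f : A ⇒ X) (g : B ⇒ X) → Pullback f g
  where open Category 𝓒
        open Morphisms 𝓒

------------------------------------------------------------------------

module WithPullbacks {o ℓ e} (𝓒 : Category o ℓ e) (pullback : HasPullbacks 𝓒) where
  open Category 𝓒
  open Morphisms 𝓒

  infix 8 _×ₚ_
  _×ₚ_ : ∀ {A B X} → A ⇒ X → B ⇒ X → Obj
  f ×ₚ g = Pullback.P (pullback f g)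

  π₁ : ∀ {A B X} (f : A ⇒ X) (g : B ⇒ X) → f ×ₚ g ⇒ A
  π₁ f g = Pullback.p₁ (pullback f g)

  π₂ : ∀ {A B X} (f : A ⇒ X) (g : B ⇒ X) → f ×ₚ g ⇒ B
  π₂ f g = Pullback.p₂ (pullback f g)

  pair : ∀ {A B X Z} (f : A ⇒ X) (g : B ⇒ X) (a : Z ⇒ A) (b : Z ⇒ B) →
         f ∘ a ≈ g ∘ b → Z ⇒ f ×ₚ g
  pair f g = Pullback.universal (pullback f g)

  infix 10 _^*_
  _^*_ : ∀ {X Y} → Y ⇒ X → Subobject X → Subobject Y
  f ^* S = record
    { arr  = π₁ f (arr S)
    ; mono = λ u v p → Pullback.unique pb u v p (mono S _ _ (begin
        arr S ∘ (π₂ f (arr S) ∘ u)  ≈⟨ Eq.sym (assoc _ _ _) ⟩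
        (arr S ∘ π₂ f (arr S)) ∘ u  ≈⟨ ∘-congʳ (Eq.sym (Pullback.commute pb)) ⟩
        (f ∘ π₁ f (arr S)) ∘ u      ≈⟨ assoc _ _ _ ⟩
        f ∘ (π₁ f (arr S) ∘ u)      ≈⟨ ∘-congˡ p ⟩
        f ∘ (π₁ f (arr S) ∘ v)      ≈⟨ Eq.sym (assoc _ _ _) ⟩
        (f ∘ π₁ f (arr S)) ∘ v      ≈⟨ ∘-congʳ (Pullback.commute pb) ⟩
        (arr S ∘ π₂ f (arr S)) ∘ v  ≈⟨ assoc _ _ _ ⟩
        arr S ∘ (π₂ f (arr S) ∘ v)  ∎))
    }
    where open Subobject
          open HomReasoning
          pb = pullback f (arr S)

  -- For y ∘ k ≈ u, the canonical map  k × B : U ×_X B → Y ×_X B.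
  baseChange : ∀ {X Y U B} (y : Y ⇒ X) (β : B ⇒ X) (k : U ⇒ Y) {u : U ⇒ X} →
               y ∘ k ≈ u → u ×ₚ β ⇒ y ×ₚ β
  baseChange y β k {u} p = pair y β (k ∘ π₁ u β) (π₂ u β) (begin
    y ∘ (k ∘ π₁ u β)  ≈⟨ Eq.sym (assoc _ _ _) ⟩
    (y ∘ k) ∘ π₁ u β  ≈⟨ ∘-congʳ p ⟩
    u ∘ π₁ u β        ≈⟨ Pullback.commute (pullback u β) ⟩
    β ∘ π₂ u β        ∎)
    where open HomReasoning

  -- For φ : B → A over X, the canonical map  Y × φ : Y ×_X B → Y ×_X A.
  fibreMap : ∀ {X Y A B} (y : Y ⇒ X) (φ : B ⇒ A) (α : A ⇒ X) →
             y ×ₚ (α ∘ φ) ⇒ y ×ₚ α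
  fibreMap y φ α = pair y α (π₁ y (α ∘ φ)) (φ ∘ π₂ y (α ∘ φ))
    (Eq.trans (Pullback.commute (pullback y (α ∘ φ))) (assoc _ _ _))

  record QuasiPullback {D C B A} (top : D ⇒ C) (left : D ⇒ B) (bot : B ⇒ A) (right : C ⇒ A) :
                       Set (o ⊔ ℓ ⊔ e) where
    field
      commute   : bot ∘ left ≈ right ∘ top
      gap-cover : Cover (pair bot right left top commute)

  record CoveringSquare {D C B A} (top : D ⇒ C) (left : D ⇒ B) (bot : B ⇒ A) (right : C ⇒ A) :
                        Set (o ⊔ ℓ ⊔ e) where
    field
      quasiPullback : QuasiPullback top left bot right
      bot-cover     : Cover bot

  -- The exponential  g ^ f  in the slice over A; the product of z and f in the
  -- slice is z ×ₚ f with structure map z ∘ π₁.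
  record SliceExponential {A B C} (g : C ⇒ A) (f : B ⇒ A) : Set (o ⊔ ℓ ⊔ e) where
    field
      {obj}      : Obj
      map        : obj ⇒ A
      ev         : map ×ₚ f ⇒ C
      ev-over    : g ∘ ev ≈ map ∘ π₁ map f
      curry      : ∀ {Z} (z : Z ⇒ A) (h : z ×ₚ f ⇒ C) → g ∘ h ≈ z ∘ π₁ z f → Z ⇒ obj
      curry-over : ∀ {Z} (z : Z ⇒ A) (h : z ×ₚ f ⇒ C) (p : g ∘ h ≈ z ∘ π₁ z f) →
                   map ∘ curry z h p ≈ z
      ev-curry   : ∀ {Z} (z : Z ⇒ A) (h : z ×ₚ f ⇒ C) (p : g ∘ h ≈ z ∘ π₁ z f) →
                   ev ∘ baseChange map f (curry z h p) (curry-over z h p) ≈ h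
      unique     : ∀ {Z} (z : Z ⇒ A) (u v : Z ⇒ obj) (p : map ∘ u ≈ z) (q : map ∘ v ≈ z) →
                   ev ∘ baseChange map f u p ≈ ev ∘ baseChange map f v q → u ≈ v

  Exponentiable : ∀ {A B} → B ⇒ A → Set (o ⊔ ℓ ⊔ e)
  Exponentiable {A} f = ∀ {C} (g : C ⇒ A) → SliceExponential g f

------------------------------------------------------------------------

module FullnessAxiom {o ℓ e s} (𝓒 : Category o ℓ e) (pullback : HasPullbacks 𝓒)
                     (Small : ∀ {A B} → Category._⇒_ 𝓒 A B → Set s) where
  open Category 𝓒
  open Morphisms 𝓒
  open WithPullbacks 𝓒 pullback

  -- Multi-valued sections, over y : Y → X, of φ : B → A, where A lives over X
  -- via α and B via α ∘ φ.
  record Mvs {X Y A B} (φ : B ⇒ A) (α : A ⇒ X) (y : Y ⇒ X) : Set (o ⊔ ℓ ⊔ e ⊔ s) where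
    field
      sub   : Subobject (y ×ₚ (α ∘ φ))
      cover : Cover (fibreMap y φ α ∘ Subobject.arr sub)
      small : Small (fibreMap y φ α ∘ Subobject.arr sub)

  -- k^*P, as a subobject of U ×_X B for any structure map u ≈ y ∘ k of U over X.
  restrict : ∀ {X Y U A B} {φ : B ⇒ A} {α : A ⇒ X} {y : Y ⇒ X} (k : U ⇒ Y) {u : U ⇒ X} →
             y ∘ k ≈ u → Mvs φ α y → Subobject (u ×ₚ (α ∘ φ))
  restrict {φ = φ} {α} {y} k p P = baseChange y (α ∘ φ) k p ^* Mvs.sub P

  whisker : ∀ {X X′ Y Z U} (q : X′ ⇒ X) (y : Y ⇒ X′) (z : Z ⇒ X′) (k : U ⇒ Y) (l : U ⇒ Z) →
            y ∘ k ≈ z ∘ l → (q ∘ z) ∘ l ≈ (q ∘ y) ∘ k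
  whisker q y z k l p = begin
    (q ∘ z) ∘ l  ≈⟨ assoc _ _ _ ⟩
    q ∘ (z ∘ l)  ≈⟨ ∘-congˡ (Eq.sym p) ⟩
    q ∘ (y ∘ k)  ≈⟨ Eq.sym (assoc _ _ _) ⟩
    (q ∘ y) ∘ k  ∎
    where open HomReasoning

  -- k^*P ≤ l^*Q for a pair k, l with y ∘ k ≈ z ∘ l, both restrictions being
  -- taken along (q ∘ y) ∘ k ≈ (q ∘ z) ∘ l : U → X.
  record Refines {X X′ Y Z A B} (φ : B ⇒ A) (α : A ⇒ X) (q : X′ ⇒ X)
                 (y : Y ⇒ X′) (P : Mvs φ α (q ∘ y))
                 (z : Z ⇒ X′) (Q : Mvs φ α (q ∘ z)) : Set (o ⊔ ℓ ⊔ e) where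
    field
      {U}     : Obj
      k       : U ⇒ Y
      l       : U ⇒ Z
      l-cover : Cover l
      commute : y ∘ k ≈ z ∘ l
      below   : restrict k Eq.refl P ≤ restrict l (whisker q y z k l commute) Q

  record GenericMvs {X A B} (φ : B ⇒ A) (α : A ⇒ X) : Set (o ⊔ ℓ ⊔ e ⊔ s) where
    field
      {X′ Y}  : Obj
      q       : X′ ⇒ X
      q-cover : Cover q
      y       : Y ⇒ X′
      y-small : Small y
      P       : Mvs φ α (q ∘ y)
      generic : ∀ {Z} (z : Z ⇒ X′) (Q : Mvs φ α (q ∘ z)) → Refines φ α q y P z Q

  Fullness : Set (o ⊔ ℓ ⊔ e ⊔ s)
  Fullness = ∀ {X A B} (φ : B ⇒ A) (α : A ⇒ X) → Small φ → Small α → GenericMvs φ α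

------------------------------------------------------------------------

record PositiveHeyting {o ℓ e} (𝓒 : Category o ℓ e) : Set (o ⊔ ℓ ⊔ e) where
  open Category 𝓒
  open Morphisms 𝓒

  field
    ⊤          : Obj
    ⊤-terminal : IsTerminal ⊤
    pullback   : HasPullbacks 𝓒

  open IsTerminal ⊤-terminal public
  open WithPullbacks 𝓒 pullback public

  infixr 7 _⊗_
  _⊗_ : Obj → Obj → Obj
  A ⊗ B = ! {A} ×ₚ ! {B}

  fst : ∀ {A B} → A ⊗ B ⇒ A
  fst = π₁ ! !

  snd : ∀ {A B} → A ⊗ B ⇒ B
  snd = π₂ ! !

  ⟨_,_⟩ : ∀ {Z A B} → Z ⇒ A → Z ⇒ B → Z ⇒ A ⊗ B
  ⟨ a , b ⟩ = pair ! ! a b (!-unique _ _)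

  field
    image       : ∀ {A B} → A ⇒ B → Subobject B
    image-cover : ∀ {A B} (f : A ⇒ B) → A ⇒ Subobject.dom (image f)
    image-∘     : ∀ {A B} (f : A ⇒ B) → Subobject.arr (image f) ∘ image-cover f ≈ f
    image-isCover : ∀ {A B} (f : A ⇒ B) → Cover (image-cover f)
    cover-stable  : ∀ {A B X} (f : A ⇒ X) (g : B ⇒ X) → Cover g → Cover (π₁ f g)

    ⊥             : Obj
    ⊥-initial     : IsInitial ⊥
    ⊥-stable      : ∀ {A} → A ⇒ ⊥ → IsInitial A
    coproduct     : ∀ A B → Coproduct A B

  open IsInitial ⊥-initial public

  module Sum {A B : Obj} = Coproduct (coproduct A B)

  infixr 6 _⊕_
  _⊕_ : Obj → Obj → Obj
  A ⊕ B = Coproduct.obj (coproduct A B)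

  field
    i₁-mono    : ∀ {A B} → Mono (Sum.i₁ {A} {B})
    i₂-mono    : ∀ {A B} → Mono (Sum.i₂ {A} {B})
    disjoint   : ∀ {A B} → IsPullback ¡ ¡ (Sum.i₁ {A} {B}) (Sum.i₂ {A} {B})
    sum-stable : ∀ {A B Z} (f : Z ⇒ A ⊕ B) → IsCoproduct (π₁ f Sum.i₁) (π₁ f Sum.i₂)

    ∀[_]       : ∀ {X Y} → Y ⇒ X → Subobject Y → Subobject X
    ∀-adjoint  : ∀ {X Y} (f : Y ⇒ X) (S : Subobject X) (T : Subobject Y) →
                 (S ≤ ∀[ f ] T) ⇔ (f ^* S ≤ T)

  infixr 6 _⊕₁_
  _⊕₁_ : ∀ {A B A′ B′} → A ⇒ A′ → B ⇒ B′ → A ⊕ B ⇒ A′ ⊕ B′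
  f ⊕₁ g = Sum.[_,_] (Sum.i₁ ∘ f) (Sum.i₂ ∘ g)

  -- P_f(X) = Σ_{a ∈ A} X^{B_a}, i.e. the total object of (A × X → A)^f.
  module Polynomial {A B} (f : B ⇒ A) (exp : Exponentiable f) where

    module Exp (X : Obj) = SliceExponential (exp (fst {A} {X}))

    P₀ : Obj → Obj
    P₀ X = Exp.obj X

    P₁ : ∀ {X Y} → X ⇒ Y → P₀ X ⇒ P₀ Y
    P₁ {X} {Y} h = Exp.curry Y (Exp.map X)
      ⟨ fst ∘ Exp.ev X , h ∘ (snd ∘ Exp.ev X) ⟩
      (Eq.trans (Pullback.proj₁-∘ (pullback ! !) _ _ _) (Exp.ev-over X))

  record WType {A B} (f : B ⇒ A) (exp : Exponentiable f) : Set (o ⊔ ℓ ⊔ e) where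
    open Polynomial f exp
    field
      W      : Obj
      sup    : P₀ W ⇒ W
      fold   : ∀ {X} → P₀ X ⇒ X → W ⇒ X
      fold-∘ : ∀ {X} (a : P₀ X ⇒ X) → fold a ∘ sup ≈ a ∘ P₁ (fold a)
      unique : ∀ {X} (a : P₀ X ⇒ X) (u : W ⇒ X) → u ∘ sup ≈ a ∘ P₁ u → u ≈ fold a

  record NaturalNumbersObject : Set (o ⊔ ℓ ⊔ e) where
    field
      N        : Obj
      zero     : ⊤ ⇒ N
      succ     : N ⇒ N
      rec      : ∀ {X} → ⊤ ⇒ X → X ⇒ X → N ⇒ X
      rec-zero : ∀ {X} (a : ⊤ ⇒ X) (t : X ⇒ X) → rec a t ∘ zero ≈ a
      rec-succ : ∀ {X} (a : ⊤ ⇒ X) (t : X ⇒ X) → rec a t ∘ succ ≈ t ∘ rec a t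
      unique   : ∀ {X} (a : ⊤ ⇒ X) (t : X ⇒ X) (u : N ⇒ X) →
                 u ∘ zero ≈ a → u ∘ succ ≈ t ∘ u → u ≈ rec a t

  -- (a , b) ∈_T R  for generalized elements a, b : T → X.
  Related : ∀ {X T} → Subobject (X ⊗ X) → T ⇒ X → T ⇒ X → Set (ℓ ⊔ e)
  Related {_} {T} R a b = Σ[ r ∈ T ⇒ Subobject.dom R ] Subobject.arr R ∘ r ≈ ⟨ a , b ⟩

  EquivalenceRelation : ∀ {X} → Subobject (X ⊗ X) → Set (o ⊔ ℓ ⊔ e)
  EquivalenceRelation {X} R = ∀ {T} → IsEquivalence (Related {X} {T} R)

  record Quotient {X} (R : Subobject (X ⊗ X)) : Set (o ⊔ ℓ ⊔ e) where
    field
      {X/R}       : Obj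
      q           : X ⇒ X/R
      coequalizer : IsCoequalizer (fst ∘ Subobject.arr R) (snd ∘ Subobject.arr R) q
      effective   : IsPullback (fst ∘ Subobject.arr R) (snd ∘ Subobject.arr R) q q

------------------------------------------------------------------------

record IsClassOfSmallMaps {o ℓ e s} {𝓒 : Category o ℓ e} (H : PositiveHeyting 𝓒)
         (Small : ∀ {A B} → Category._⇒_ 𝓒 A B → Set s) : Set (o ⊔ ℓ ⊔ e ⊔ s) where
  open Category 𝓒
  open Morphisms 𝓒
  open PositiveHeyting H

  field
    pullback-stable : ∀ {A B C D} {p : C ⇒ A} {f : B ⇒ A} {g : D ⇒ C} {d : D ⇒ B} →
                      IsPullback g d p f → Small f → Small g
    descent         : ∀ {A B C D} {p : C ⇒ A} {f : B ⇒ A} {g : D ⇒ C} {d : D ⇒ B} →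
                      IsPullback g d p f → Cover p → Small g → Small f
    sums            : ∀ {X Y X′ Y′} {f : X ⇒ Y} {f′ : X′ ⇒ Y′} →
                      Small f → Small f′ → Small (f ⊕₁ f′)
    0→1-small       : Small (! {⊥})
    1→1-small       : Small (! {⊤})
    1+1→1-small     : Small (! {⊤ ⊕ ⊤})
    composition     : ∀ {X Y Z} {g : Y ⇒ Z} {f : X ⇒ Y} → Small g → Small f → Small (g ∘ f)
    quotients       : ∀ {X Y Z} {f : Z ⇒ X} {g : X ⇒ Y} →
                      Cover f → Small (g ∘ f) → Small g
    collection      : ∀ {X Y A} (p : Y ⇒ X) (f : X ⇒ A) → Cover p → Small f →
                      Σ[ Z ∈ Obj ] Σ[ B ∈ Obj ]
                      Σ[ z ∈ Z ⇒ Y ] Σ[ g ∈ Z ⇒ B ] Σ[ h ∈ B ⇒ A ]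
                        (Small g × CoveringSquare (p ∘ z) g h f)
    heyting         : ∀ {X Y} {f : Y ⇒ X} (T : Subobject Y) → Small f →
                      Small (Subobject.arr T) → Small (Subobject.arr (∀[ f ] T))
    diagonals       : ∀ {X} → Small (⟨ id {X} , id ⟩)

record PredicativeCategoryWithSmallMaps (o ℓ e s : Level) :
         Set (suc (o ⊔ ℓ ⊔ e ⊔ s)) where
  field
    category        : Category o ℓ e
    positiveHeyting : PositiveHeyting category

  open Category category public
  open Morphisms category public
  open PositiveHeyting positiveHeyting public

  field
    Small              : ∀ {A B} → A ⇒ B → Set s
    isClassOfSmallMaps : IsClassOfSmallMaps positiveHeyting Small

    exponentiable : ∀ {A B} (f : B ⇒ A) → Small f → Exponentiable f
    wType         : ∀ {A B} (f : B ⇒ A) (f-small : Small f) → WType f (exponentiable f f-small)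

    nno           : NaturalNumbersObject
    nno-small     : Small (! {NaturalNumbersObject.N nno})

    {El U}        : Obj
    el            : El ⇒ U
    el-small      : Small el
    -- Every small map is covered by a pullback of the universal one.
    universal     : ∀ {X Y} (f : Y ⇒ X) → Small f →
                    Σ[ A ∈ Obj ] Σ[ B ∈ Obj ] Σ[ g ∈ B ⇒ A ]
                    Σ[ b ∈ B ⇒ Y ] Σ[ a ∈ A ⇒ X ] Σ[ d ∈ B ⇒ El ] Σ[ c ∈ A ⇒ U ]
                      (CoveringSquare b g a f × IsPullback g d c el)

    boundedExactness : ∀ {X} (R : Subobject (X ⊗ X)) → Small (Subobject.arr R) →
                       EquivalenceRelation R → Quotient R

------------------------------------------------------------------------

-- Laws of internal categories and presheaves are stated on generalized elements;
-- the proofs quantified over in them are side conditions that always hold.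

record InternalCategory {o ℓ e} (𝓔 : Category o ℓ e) (pullback : HasPullbacks 𝓔) :
                        Set (o ⊔ ℓ ⊔ e) where
  open Category 𝓔
  open Morphisms 𝓔
  open WithPullbacks 𝓔 pullback

  infix 8 _⊙_[_]

  field
    {C₀ C₁}  : Obj
    dom cod  : C₁ ⇒ C₀
    idn      : C₀ ⇒ C₁
    comp     : dom ×ₚ cod ⇒ C₁
    dom-idn  : dom ∘ idn ≈ id
    cod-idn  : cod ∘ idn ≈ id
    dom-comp : dom ∘ comp ≈ dom ∘ π₂ dom cod
    cod-comp : cod ∘ comp ≈ cod ∘ π₁ dom cod

  _⊙_[_] : ∀ {T} (f g : T ⇒ C₁) → dom ∘ f ≈ cod ∘ g → T ⇒ C₁
  f ⊙ g [ p ] = comp ∘ pair dom cod f g p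

  field
    identityˡ-⊙ : ∀ {T} (f : T ⇒ C₁) (p : dom ∘ (idn ∘ (cod ∘ f)) ≈ cod ∘ f) →
                  (idn ∘ (cod ∘ f)) ⊙ f [ p ] ≈ f
    identityʳ-⊙ : ∀ {T} (f : T ⇒ C₁) (p : dom ∘ f ≈ cod ∘ (idn ∘ (dom ∘ f))) →
                  f ⊙ (idn ∘ (dom ∘ f)) [ p ] ≈ f
    assoc-⊙     : ∀ {T} (f g h : T ⇒ C₁)
                  (p : dom ∘ f ≈ cod ∘ g) (q : dom ∘ g ≈ cod ∘ h)
                  (r : dom ∘ (f ⊙ g [ p ]) ≈ cod ∘ h) (s : dom ∘ f ≈ cod ∘ (g ⊙ h [ q ])) →
                  (f ⊙ g [ p ]) ⊙ h [ r ] ≈ f ⊙ (g ⊙ h [ q ]) [ s ]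

-- An operation, internal to 𝓔, sending a cospan (f , g) in ℂ to a pullback square.
record ChosenPullbacks {o ℓ e} {𝓔 : Category o ℓ e} {pullback : HasPullbacks 𝓔}
                       (ℂ : InternalCategory 𝓔 pullback) : Set (o ⊔ ℓ ⊔ e) where
  open Category 𝓔
  open WithPullbacks 𝓔 pullback
  open InternalCategory ℂ

  Cospan : Obj
  Cospan = cod ×ₚ cod

  left : Cospan ⇒ C₁
  left = π₁ cod cod

  right : Cospan ⇒ C₁
  right = π₂ cod cod

  field
    pr₁ pr₂   : Cospan ⇒ C₁
    dom-pr    : dom ∘ pr₁ ≈ dom ∘ pr₂
    cod-pr₁   : dom ∘ left ≈ cod ∘ pr₁
    cod-pr₂   : dom ∘ right ≈ cod ∘ pr₂
    commute   : left ⊙ pr₁ [ cod-pr₁ ] ≈ right ⊙ pr₂ [ cod-pr₂ ]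
    factor    : ∀ {T} (c : T ⇒ Cospan) (a b : T ⇒ C₁)
                (p : dom ∘ (left ∘ c) ≈ cod ∘ a) (q : dom ∘ (right ∘ c) ≈ cod ∘ b) →
                (left ∘ c) ⊙ a [ p ] ≈ (right ∘ c) ⊙ b [ q ] →
                Σ[ t ∈ T ⇒ C₁ ]
                Σ[ r ∈ dom ∘ (pr₁ ∘ c) ≈ cod ∘ t ] Σ[ s ∈ dom ∘ (pr₂ ∘ c) ≈ cod ∘ t ]
                  ((pr₁ ∘ c) ⊙ t [ r ] ≈ a × (pr₂ ∘ c) ⊙ t [ s ] ≈ b)
    unique    : ∀ {T} (c : T ⇒ Cospan) (t t′ : T ⇒ C₁)
                (r : dom ∘ (pr₁ ∘ c) ≈ cod ∘ t) (r′ : dom ∘ (pr₁ ∘ c) ≈ cod ∘ t′)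
                (s : dom ∘ (pr₂ ∘ c) ≈ cod ∘ t) (s′ : dom ∘ (pr₂ ∘ c) ≈ cod ∘ t′) →
                (pr₁ ∘ c) ⊙ t [ r ] ≈ (pr₁ ∘ c) ⊙ t′ [ r′ ] →
                (pr₂ ∘ c) ⊙ t [ s ] ≈ (pr₂ ∘ c) ⊙ t′ [ s′ ] →
                t ≈ t′

------------------------------------------------------------------------

module Presheaves {o ℓ e} (𝓔 : Category o ℓ e) (pullback : HasPullbacks 𝓔)
                  (ℂ : InternalCategory 𝓔 pullback) where
  open Category 𝓔
  open Morphisms 𝓔
  open WithPullbacks 𝓔 pullback
  open InternalCategory ℂ
  open HomReasoning

  private
    pair-∘ : ∀ {A B X Z T} {f : A ⇒ X} {g : B ⇒ X} {a : Z ⇒ A} {b : Z ⇒ B} (t : T ⇒ Z)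
             {p : f ∘ a ≈ g ∘ b} {q : f ∘ (a ∘ t) ≈ g ∘ (b ∘ t)} →
             pair f g a b p ∘ t ≈ pair f g (a ∘ t) (b ∘ t) q
    pair-∘ {f = f} {g} {a} {b} t {p} {q} = Pullback.unique pb _ _
      (begin
        π₁ f g ∘ (pair f g a b p ∘ t)        ≈⟨ Eq.sym (assoc _ _ _) ⟩
        (π₁ f g ∘ pair f g a b p) ∘ t        ≈⟨ ∘-congʳ (Pullback.proj₁-∘ pb _ _ _) ⟩
        a ∘ t                                ≈⟨ Eq.sym (Pullback.proj₁-∘ pb _ _ _) ⟩
        π₁ f g ∘ pair f g (a ∘ t) (b ∘ t) q  ∎)
      (begin
        π₂ f g ∘ (pair f g a b p ∘ t)        ≈⟨ Eq.sym (assoc _ _ _) ⟩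
        (π₂ f g ∘ pair f g a b p) ∘ t        ≈⟨ ∘-congʳ (Pullback.proj₂-∘ pb _ _ _) ⟩
        b ∘ t                                ≈⟨ Eq.sym (Pullback.proj₂-∘ pb _ _ _) ⟩
        π₂ f g ∘ pair f g (a ∘ t) (b ∘ t) q  ∎)
      where pb = pullback f g

    pair-cong : ∀ {A B X Z} {f : A ⇒ X} {g : B ⇒ X} {a a′ : Z ⇒ A} {b b′ : Z ⇒ B}
                {p : f ∘ a ≈ g ∘ b} {q : f ∘ a′ ≈ g ∘ b′} →
                a ≈ a′ → b ≈ b′ → pair f g a b p ≈ pair f g a′ b′ q
    pair-cong {f = f} {g} a≈ b≈ = Pullback.unique pb _ _
      (Eq.trans (Pullback.proj₁-∘ pb _ _ _) (Eq.trans a≈ (Eq.sym (Pullback.proj₁-∘ pb _ _ _))))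
      (Eq.trans (Pullback.proj₂-∘ pb _ _ _) (Eq.trans b≈ (Eq.sym (Pullback.proj₂-∘ pb _ _ _))))
      where pb = pullback f g

    pull : ∀ {A B C D} {h : C ⇒ D} {g : B ⇒ C} {k : B ⇒ D} {f : A ⇒ B} →
           h ∘ g ≈ k → h ∘ (g ∘ f) ≈ k ∘ f
    pull p = Eq.trans (Eq.sym (assoc _ _ _)) (∘-congʳ p)

  record Presheaf : Set (o ⊔ ℓ ⊔ e) where
    infix 8 _·_[_]
    field
      {obj}   : Obj
      π       : obj ⇒ C₀
      act     : π ×ₚ cod ⇒ obj
      act-dom : π ∘ act ≈ dom ∘ π₂ π cod

    _·_[_] : ∀ {T} (x : T ⇒ obj) (f : T ⇒ C₁) → π ∘ x ≈ cod ∘ f → T ⇒ obj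
    x · f [ p ] = act ∘ pair π cod x f p

    field
      act-idn : ∀ {T} (x : T ⇒ obj) (p : π ∘ x ≈ cod ∘ (idn ∘ (π ∘ x))) →
                x · idn ∘ (π ∘ x) [ p ] ≈ x
      act-⊙   : ∀ {T} (x : T ⇒ obj) (f g : T ⇒ C₁)
                (p : π ∘ x ≈ cod ∘ f) (q : π ∘ (x · f [ p ]) ≈ cod ∘ g)
                (r : dom ∘ f ≈ cod ∘ g) (s : π ∘ x ≈ cod ∘ (f ⊙ g [ r ])) →
                (x · f [ p ]) · g [ q ] ≈ x · f ⊙ g [ r ] [ s ]

    π-· : ∀ {T} (x : T ⇒ obj) (f : T ⇒ C₁) (p : π ∘ x ≈ cod ∘ f) →
          π ∘ (x · f [ p ]) ≈ dom ∘ f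
    π-· x f p = begin
      π ∘ (act ∘ pair π cod x f p)            ≈⟨ pull act-dom ⟩
      (dom ∘ π₂ π cod) ∘ pair π cod x f p     ≈⟨ assoc _ _ _ ⟩
      dom ∘ (π₂ π cod ∘ pair π cod x f p)     ≈⟨ ∘-congˡ (Pullback.proj₂-∘ (pullback π cod) _ _ _) ⟩
      dom ∘ f                                 ∎

    ·-∘ : ∀ {T S} {x : T ⇒ obj} {f : T ⇒ C₁} {p : π ∘ x ≈ cod ∘ f} (t : S ⇒ T)
          {q : π ∘ (x ∘ t) ≈ cod ∘ (f ∘ t)} →
          (x · f [ p ]) ∘ t ≈ (x ∘ t) · f ∘ t [ q ]
    ·-∘ t = Eq.trans (assoc _ _ _) (∘-congˡ (pair-∘ t))

    ·-cong : ∀ {T} {x x′ : T ⇒ obj} {f f′ : T ⇒ C₁}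
             {p : π ∘ x ≈ cod ∘ f} {q : π ∘ x′ ≈ cod ∘ f′} →
             x ≈ x′ → f ≈ f′ → x · f [ p ] ≈ x′ · f′ [ q ]
    ·-cong x≈ f≈ = ∘-congˡ (pair-cong x≈ f≈)

    -- The generic pair (x , f) with π x = cod f.
    elt : π ×ₚ cod ⇒ obj
    elt = π₁ π cod

    mor : π ×ₚ cod ⇒ C₁
    mor = π₂ π cod

    elt-mor : π ∘ elt ≈ cod ∘ mor
    elt-mor = Pullback.commute (pullback π cod)

  open Presheaf

  record PshHom (X Y : Presheaf) : Set (ℓ ⊔ e) where
    private
      module X = Presheaf X
      module Y = Presheaf Y
    field
      arr  : X.obj ⇒ Y.obj
      over : Y.π ∘ arr ≈ X.π

    over-elt : Y.π ∘ (arr ∘ X.elt) ≈ cod ∘ X.mor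
    over-elt = Eq.trans (pull over) X.elt-mor

    field
      equivariant : arr ∘ X.act ≈ (arr ∘ X.elt) Y.· X.mor [ over-elt ]

    equivariant-elt : ∀ {T} (x : T ⇒ X.obj) (f : T ⇒ C₁)
                      (p : X.π ∘ x ≈ cod ∘ f) (q : Y.π ∘ (arr ∘ x) ≈ cod ∘ f) →
                      arr ∘ (x X.· f [ p ]) ≈ (arr ∘ x) Y.· f [ q ]
    equivariant-elt x f p q = begin
      arr ∘ (X.act ∘ t)                        ≈⟨ pull equivariant ⟩
      ((arr ∘ X.elt) Y.· X.mor [ over-elt ]) ∘ t
        ≈⟨ Y.·-∘ t {Eq.trans (∘-congˡ x≈) (Eq.trans q (∘-congˡ (Eq.sym f≈)))} ⟩
      ((arr ∘ X.elt) ∘ t) Y.· X.mor ∘ t [ _ ]  ≈⟨ Y.·-cong x≈ f≈ ⟩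
      (arr ∘ x) Y.· f [ q ]                    ∎
      where
        pb = pullback X.π cod
        t  = pair X.π cod x f p
        x≈ : (arr ∘ X.elt) ∘ t ≈ arr ∘ x
        x≈ = Eq.trans (assoc _ _ _) (∘-congˡ (Pullback.proj₁-∘ pb _ _ _))
        f≈ : X.mor ∘ t ≈ f
        f≈ = Pullback.proj₂-∘ pb _ _ _

  open PshHom

  private
    idHom : ∀ {X} → PshHom X X
    idHom {X} = record
      { arr         = id
      ; over        = identityʳ _
      ; equivariant = begin
          id ∘ act X                              ≈⟨ identityˡ _ ⟩
          act X                                   ≈⟨ Eq.sym (identityʳ _) ⟩
          act X ∘ id                              ≈⟨ ∘-congˡ (Pullback.unique pb _ _
            (begin
              elt X ∘ id                          ≈⟨ identityʳ _ ⟩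
              elt X                               ≈⟨ Eq.sym (identityˡ _) ⟩
              id ∘ elt X                          ≈⟨ Eq.sym (Pullback.proj₁-∘ pb _ _ _) ⟩
              elt X ∘ pair (π X) cod (id ∘ elt X) (mor X) _ ∎)
            (begin
              mor X ∘ id                          ≈⟨ identityʳ _ ⟩
              mor X                               ≈⟨ Eq.sym (Pullback.proj₂-∘ pb _ _ _) ⟩
              mor X ∘ pair (π X) cod (id ∘ elt X) (mor X) _ ∎)) ⟩
          _·_[_] X (id ∘ elt X) (mor X) _         ∎
      }
      where pb = pullback (π X) cod

    compHom : ∀ {X Y Z} → PshHom Y Z → PshHom X Y → PshHom X Z
    compHom {X} {Y} {Z} g f = record
      { arr         = arr g ∘ arr f
      ; over        = Eq.trans (pull (over g)) (over f)
      ; equivariant = begin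
          (arr g ∘ arr f) ∘ act X                              ≈⟨ assoc _ _ _ ⟩
          arr g ∘ (arr f ∘ act X)                              ≈⟨ ∘-congˡ (equivariant f) ⟩
          arr g ∘ (_·_[_] Y (arr f ∘ elt X) (mor X) _)         ≈⟨ equivariant-elt g _ _ _ c ⟩
          _·_[_] Z (arr g ∘ (arr f ∘ elt X)) (mor X) c         ≈⟨ ·-cong Z (Eq.sym (assoc _ _ _)) Eq.refl ⟩
          _·_[_] Z ((arr g ∘ arr f) ∘ elt X) (mor X) _         ∎
      }
      where
        c : π Z ∘ (arr g ∘ (arr f ∘ elt X)) ≈ cod ∘ mor X
        c = Eq.trans (pull (over g)) (over-elt f)

  Psh : Category (o ⊔ ℓ ⊔ e) (ℓ ⊔ e) e
  Psh = record
    { Obj       = Presheaf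
    ; _⇒_       = PshHom
    ; _≈_       = λ f g → arr f ≈ arr g
    ; id        = idHom
    ; _∘_       = compHom
    ; assoc     = λ h g f → assoc (arr h) (arr g) (arr f)
    ; identityˡ = λ f → identityˡ (arr f)
    ; identityʳ = λ f → identityʳ (arr f)
    ; equiv     = record { refl = Eq.refl ; sym = Eq.sym ; trans = Eq.trans }
    ; ∘-cong    = ∘-cong
    }

  -- Covers in Psh are taken in the intrinsic sense of Morphisms.Cover; when 𝓔 is
  -- regular these are exactly the f for which arr f is a cover in 𝓔.
  PointwiseSmall : ∀ {s} → (∀ {A B} → A ⇒ B → Set s) → ∀ {X Y} → PshHom X Y → Set s
  PointwiseSmall Small f = Small (arr f)

  module _ {X Y Z : Presheaf} (f : PshHom X Z) (g : PshHom Y Z) where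
    private
      module X = Presheaf X
      module Y = Presheaf Y
      module Z = Presheaf Z

      pb = pullback (arr f) (arr g)
      open Pullback pb renaming (P to Q; p₁ to q₁; p₂ to q₂)

      πQ : Q ⇒ C₀
      πQ = X.π ∘ q₁

      πQ≈ : πQ ≈ Y.π ∘ q₂
      πQ≈ = begin
        X.π ∘ q₁              ≈⟨ ∘-congʳ (Eq.sym (over f)) ⟩
        (Z.π ∘ arr f) ∘ q₁    ≈⟨ assoc _ _ _ ⟩
        Z.π ∘ (arr f ∘ q₁)    ≈⟨ ∘-congˡ commute ⟩
        Z.π ∘ (arr g ∘ q₂)    ≈⟨ pull (over g) ⟩
        Y.π ∘ q₂              ∎

      over₁ : ∀ {T} {x : T ⇒ Q} {c : T ⇒ C₀} → πQ ∘ x ≈ c → X.π ∘ (q₁ ∘ x) ≈ c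
      over₁ p = Eq.trans (Eq.sym (assoc _ _ _)) p

      over₂ : ∀ {T} {x : T ⇒ Q} {c : T ⇒ C₀} → πQ ∘ x ≈ c → Y.π ∘ (q₂ ∘ x) ≈ c
      over₂ p = Eq.trans (pull (Eq.sym πQ≈)) p

      module _ {T} (x : T ⇒ Q) (h : T ⇒ C₁) (p : πQ ∘ x ≈ cod ∘ h) where

        agree : arr f ∘ ((q₁ ∘ x) X.· h [ over₁ p ]) ≈ arr g ∘ ((q₂ ∘ x) Y.· h [ over₂ p ])
        agree = begin
          arr f ∘ ((q₁ ∘ x) X.· h [ _ ])   ≈⟨ equivariant-elt f _ _ _ c₁ ⟩
          (arr f ∘ (q₁ ∘ x)) Z.· h [ c₁ ]  ≈⟨ Z.·-cong fg Eq.refl ⟩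
          (arr g ∘ (q₂ ∘ x)) Z.· h [ c₂ ]  ≈⟨ Eq.sym (equivariant-elt g _ _ _ c₂) ⟩
          arr g ∘ ((q₂ ∘ x) Y.· h [ _ ])   ∎
          where
            c₁ : Z.π ∘ (arr f ∘ (q₁ ∘ x)) ≈ cod ∘ h
            c₁ = Eq.trans (pull (over f)) (over₁ p)
            c₂ : Z.π ∘ (arr g ∘ (q₂ ∘ x)) ≈ cod ∘ h
            c₂ = Eq.trans (pull (over g)) (over₂ p)
            fg : arr f ∘ (q₁ ∘ x) ≈ arr g ∘ (q₂ ∘ x)
            fg = Eq.trans (pull commute) (assoc _ _ _)

      eltQ : πQ ×ₚ cod ⇒ Q
      eltQ = π₁ πQ cod

      morQ : πQ ×ₚ cod ⇒ C₁
      morQ = π₂ πQ cod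

      elt-morQ : πQ ∘ eltQ ≈ cod ∘ morQ
      elt-morQ = Pullback.commute (pullback πQ cod)

      actQ : πQ ×ₚ cod ⇒ Q
      actQ = universal _ _ (agree eltQ morQ elt-morQ)

      q₁-act : ∀ {T} (x : T ⇒ Q) (h : T ⇒ C₁) (p : πQ ∘ x ≈ cod ∘ h) →
               q₁ ∘ (actQ ∘ pair πQ cod x h p) ≈ (q₁ ∘ x) X.· h [ over₁ p ]
      q₁-act x h p = begin
        q₁ ∘ (actQ ∘ t)                                     ≈⟨ pull (proj₁-∘ _ _ _) ⟩
        ((q₁ ∘ eltQ) X.· morQ [ over₁ elt-morQ ]) ∘ t
          ≈⟨ X.·-∘ t {Eq.trans (∘-congˡ x≈) (Eq.trans (over₁ p) (∘-congˡ (Eq.sym h≈)))} ⟩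
        ((q₁ ∘ eltQ) ∘ t) X.· morQ ∘ t [ _ ]                ≈⟨ X.·-cong x≈ h≈ ⟩
        (q₁ ∘ x) X.· h [ over₁ p ]                          ∎
        where
          t  = pair πQ cod x h p
          x≈ : (q₁ ∘ eltQ) ∘ t ≈ q₁ ∘ x
          x≈ = Eq.trans (assoc _ _ _) (∘-congˡ (Pullback.proj₁-∘ (pullback πQ cod) _ _ _))
          h≈ : morQ ∘ t ≈ h
          h≈ = Pullback.proj₂-∘ (pullback πQ cod) _ _ _

      q₂-act : ∀ {T} (x : T ⇒ Q) (h : T ⇒ C₁) (p : πQ ∘ x ≈ cod ∘ h) →
               q₂ ∘ (actQ ∘ pair πQ cod x h p) ≈ (q₂ ∘ x) Y.· h [ over₂ p ]
      q₂-act x h p = begin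
        q₂ ∘ (actQ ∘ t)                                     ≈⟨ pull (proj₂-∘ _ _ _) ⟩
        ((q₂ ∘ eltQ) Y.· morQ [ over₂ elt-morQ ]) ∘ t
          ≈⟨ Y.·-∘ t {Eq.trans (∘-congˡ x≈) (Eq.trans (over₂ p) (∘-congˡ (Eq.sym h≈)))} ⟩
        ((q₂ ∘ eltQ) ∘ t) Y.· morQ ∘ t [ _ ]                ≈⟨ Y.·-cong x≈ h≈ ⟩
        (q₂ ∘ x) Y.· h [ over₂ p ]                          ∎
        where
          t  = pair πQ cod x h p
          x≈ : (q₂ ∘ eltQ) ∘ t ≈ q₂ ∘ x
          x≈ = Eq.trans (assoc _ _ _) (∘-congˡ (Pullback.proj₁-∘ (pullback πQ cod) _ _ _))
          h≈ : morQ ∘ t ≈ h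
          h≈ = Pullback.proj₂-∘ (pullback πQ cod) _ _ _

      πQ-act : πQ ∘ actQ ≈ dom ∘ morQ
      πQ-act = begin
        (X.π ∘ q₁) ∘ actQ   ≈⟨ assoc _ _ _ ⟩
        X.π ∘ (q₁ ∘ actQ)   ≈⟨ ∘-congˡ (proj₁-∘ _ _ _) ⟩
        X.π ∘ ((q₁ ∘ eltQ) X.· morQ [ over₁ elt-morQ ]) ≈⟨ X.π-· _ _ _ ⟩
        dom ∘ morQ          ∎

      module _ {T} (x : T ⇒ Q) (p : πQ ∘ x ≈ cod ∘ (idn ∘ (πQ ∘ x))) where

        act-idn₁ : q₁ ∘ (actQ ∘ pair πQ cod x (idn ∘ (πQ ∘ x)) p) ≈ q₁ ∘ x
        act-idn₁ = begin
          q₁ ∘ (actQ ∘ pair πQ cod x (idn ∘ (πQ ∘ x)) p)      ≈⟨ q₁-act _ _ _ ⟩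
          (q₁ ∘ x) X.· idn ∘ (πQ ∘ x) [ _ ]                   ≈⟨ X.·-cong Eq.refl h≈ ⟩
          (q₁ ∘ x) X.· idn ∘ (X.π ∘ (q₁ ∘ x)) [ c ]           ≈⟨ X.act-idn _ _ ⟩
          q₁ ∘ x                                              ∎
          where
            h≈ : idn ∘ (πQ ∘ x) ≈ idn ∘ (X.π ∘ (q₁ ∘ x))
            h≈ = ∘-congˡ (assoc _ _ _)
            c : X.π ∘ (q₁ ∘ x) ≈ cod ∘ (idn ∘ (X.π ∘ (q₁ ∘ x)))
            c = Eq.trans (over₁ p) (∘-congˡ h≈)

        act-idn₂ : q₂ ∘ (actQ ∘ pair πQ cod x (idn ∘ (πQ ∘ x)) p) ≈ q₂ ∘ x
        act-idn₂ = begin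
          q₂ ∘ (actQ ∘ pair πQ cod x (idn ∘ (πQ ∘ x)) p)      ≈⟨ q₂-act _ _ _ ⟩
          (q₂ ∘ x) Y.· idn ∘ (πQ ∘ x) [ _ ]                   ≈⟨ Y.·-cong Eq.refl h≈ ⟩
          (q₂ ∘ x) Y.· idn ∘ (Y.π ∘ (q₂ ∘ x)) [ c ]           ≈⟨ Y.act-idn _ _ ⟩
          q₂ ∘ x                                              ∎
          where
            h≈ : idn ∘ (πQ ∘ x) ≈ idn ∘ (Y.π ∘ (q₂ ∘ x))
            h≈ = ∘-congˡ (Eq.trans (∘-congʳ πQ≈) (assoc _ _ _))
            c : Y.π ∘ (q₂ ∘ x) ≈ cod ∘ (idn ∘ (Y.π ∘ (q₂ ∘ x)))
            c = Eq.trans (over₂ p) (∘-congˡ h≈)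

      module _ {T} (x : T ⇒ Q) (h k : T ⇒ C₁) (p : πQ ∘ x ≈ cod ∘ h)
               (q : πQ ∘ (actQ ∘ pair πQ cod x h p) ≈ cod ∘ k)
               (r : dom ∘ h ≈ cod ∘ k) (s : πQ ∘ x ≈ cod ∘ (h ⊙ k [ r ])) where

        xh : T ⇒ Q
        xh = actQ ∘ pair πQ cod x h p

        act-⊙₁ : q₁ ∘ (actQ ∘ pair πQ cod xh k q) ≈
                 q₁ ∘ (actQ ∘ pair πQ cod x (h ⊙ k [ r ]) s)
        act-⊙₁ = begin
          q₁ ∘ (actQ ∘ pair πQ cod xh k q)                 ≈⟨ q₁-act _ _ _ ⟩
          (q₁ ∘ xh) X.· k [ _ ]                            ≈⟨ X.·-cong (q₁-act x h p) Eq.refl ⟩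
          ((q₁ ∘ x) X.· h [ over₁ p ]) X.· k [ c ]         ≈⟨ X.act-⊙ _ _ _ _ _ r (over₁ s) ⟩
          (q₁ ∘ x) X.· h ⊙ k [ r ] [ over₁ s ]             ≈⟨ Eq.sym (q₁-act _ _ _) ⟩
          q₁ ∘ (actQ ∘ pair πQ cod x (h ⊙ k [ r ]) s)      ∎
          where
            c : X.π ∘ ((q₁ ∘ x) X.· h [ over₁ p ]) ≈ cod ∘ k
            c = Eq.trans (X.π-· _ _ _) r

        act-⊙₂ : q₂ ∘ (actQ ∘ pair πQ cod xh k q) ≈
                 q₂ ∘ (actQ ∘ pair πQ cod x (h ⊙ k [ r ]) s)
        act-⊙₂ = begin
          q₂ ∘ (actQ ∘ pair πQ cod xh k q)                 ≈⟨ q₂-act _ _ _ ⟩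
          (q₂ ∘ xh) Y.· k [ _ ]                            ≈⟨ Y.·-cong (q₂-act x h p) Eq.refl ⟩
          ((q₂ ∘ x) Y.· h [ over₂ p ]) Y.· k [ c ]         ≈⟨ Y.act-⊙ _ _ _ _ _ r (over₂ s) ⟩
          (q₂ ∘ x) Y.· h ⊙ k [ r ] [ over₂ s ]             ≈⟨ Eq.sym (q₂-act _ _ _) ⟩
          q₂ ∘ (actQ ∘ pair πQ cod x (h ⊙ k [ r ]) s)      ∎
          where
            c : Y.π ∘ ((q₂ ∘ x) Y.· h [ over₂ p ]) ≈ cod ∘ k
            c = Eq.trans (Y.π-· _ _ _) r

    pullbackPresheaf : Presheaf
    pullbackPresheaf = record
      { π       = πQ
      ; act     = actQ
      ; act-dom = πQ-act
      ; act-idn = λ x p → unique _ _ (act-idn₁ x p) (act-idn₂ x p)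
      ; act-⊙   = λ x h k p q r s →
          unique _ _ (act-⊙₁ x h k p q r s) (act-⊙₂ x h k p q r s)
      }

    private
      mediate : ∀ {W} (a : PshHom W X) (b : PshHom W Y) →
                arr f ∘ arr a ≈ arr g ∘ arr b → PshHom W pullbackPresheaf
      mediate {W} a b c = record
        { arr         = m
        ; over        = Eq.trans (assoc _ _ _) (Eq.trans (∘-congˡ (proj₁-∘ _ _ _)) (over a))
        ; equivariant = unique _ _
            (begin
              q₁ ∘ (m ∘ act W)                                 ≈⟨ pull (proj₁-∘ _ _ _) ⟩
              arr a ∘ act W                                    ≈⟨ equivariant a ⟩
              (arr a ∘ elt W) X.· mor W [ _ ]
                ≈⟨ X.·-cong (Eq.sym (pull (proj₁-∘ _ _ _))) Eq.refl ⟩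
              (q₁ ∘ (m ∘ elt W)) X.· mor W [ _ ]               ≈⟨ Eq.sym (q₁-act _ _ _) ⟩
              q₁ ∘ (actQ ∘ pair πQ cod (m ∘ elt W) (mor W) _)  ∎)
            (begin
              q₂ ∘ (m ∘ act W)                                 ≈⟨ pull (proj₂-∘ _ _ _) ⟩
              arr b ∘ act W                                    ≈⟨ equivariant b ⟩
              (arr b ∘ elt W) Y.· mor W [ _ ]
                ≈⟨ Y.·-cong (Eq.sym (pull (proj₂-∘ _ _ _))) Eq.refl ⟩
              (q₂ ∘ (m ∘ elt W)) Y.· mor W [ _ ]               ≈⟨ Eq.sym (q₂-act _ _ _) ⟩
              q₂ ∘ (actQ ∘ pair πQ cod (m ∘ elt W) (mor W) _)  ∎)
        }
        where
          m : obj W ⇒ Q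
          m = universal (arr a) (arr b) c

    pullbackPsh : Morphisms.Pullback Psh f g
    pullbackPsh = record
      { P          = pullbackPresheaf
      ; p₁         = record
          { arr         = q₁
          ; over        = Eq.refl
          ; equivariant = Eq.trans (proj₁-∘ _ _ _) (X.·-cong Eq.refl Eq.refl)
          }
      ; p₂         = record
          { arr         = q₂
          ; over        = Eq.sym πQ≈
          ; equivariant = Eq.trans (proj₂-∘ _ _ _) (Y.·-cong Eq.refl Eq.refl)
          }
      ; isPullback = record
          { commute   = commute
          ; universal = mediate
          ; proj₁-∘   = λ a b c → proj₁-∘ (arr a) (arr b) c
          ; proj₂-∘   = λ a b c → proj₂-∘ (arr a) (arr b) c
          ; unique    = λ u v → unique (arr u) (arr v)
          }
      }

  Psh-pullbacks : HasPullbacks Psh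
  Psh-pullbacks = pullbackPsh

{-# OPTIONS --safe #-}
module Submission where

open import Level using (_⊔_)
open import Data.Product using (Σ-syntax; _×_; _,_; proj₁; proj₂)
open import Relation.Binary.PropositionalEquality using (_≡_; refl)
open import Defs

-- Write A_x · g for the elements of A over x · g.  For x ∈ X(c) let Ā_x be the sum of the
-- A_x · g over all g : d → c, a small family since cod is small, and likewise B̄_x.  A
-- multi-valued section of φ over x is the same as an action-closed multi-valued section of
-- B̄_x → Ā_x, and every multi-valued section S of B̄_x → Ā_x generates the smallest
-- action-closed one containing it.  Hence fullness in 𝓔 over the object of X provides, over a
-- cover q₁ : X₁ → X, a small family of multi-valued sections of φ below each given one.
-- Chosen lifts to X₁ cannot be made functorial, so Collection is applied to X₁ pulled back
-- along the action: over a cover W → X, each w ∈ W over x carries a small family N_w of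
-- pairs of an arrow g and a lift of x · g to X₁, in which every g occurs.  Then X′ is the
-- free presheaf on W, and Y is the free presheaf on the triples of w, n ∈ N_w and an index
-- of a section over the lift of n.  As Y is free, no compatibility between the sections
-- attached to its generators is required, and as cod is small, Y → X′ is small: an element
-- of Y over w · e is a factorization e = g ∘ k together with small data.

-- Covers, monos and pullbacks in a category.

module CategoryLemmas {o ℓ e} (𝓒 : Category o ℓ e) where
  open Category 𝓒
  open Morphisms 𝓒

  infixr 5 _∙_
  _∙_ : ∀ {A B} {f g h : A ⇒ B} → f ≈ g → g ≈ h → f ≈ h
  _∙_ = Eq.trans

  pullˡ : ∀ {A B C D} {h : C ⇒ D} {g : B ⇒ C} {k : B ⇒ D} {f : A ⇒ B} →
          h ∘ g ≈ k → h ∘ (g ∘ f) ≈ k ∘ f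
  pullˡ p = Eq.sym (assoc _ _ _) ∙ ∘-congʳ p

  extend : ∀ {A B C C′ D} {h : C ⇒ D} {g : B ⇒ C} {h′ : C′ ⇒ D} {g′ : B ⇒ C′} {f : A ⇒ B} →
           h ∘ g ≈ h′ ∘ g′ → h ∘ (g ∘ f) ≈ h′ ∘ (g′ ∘ f)
  extend p = pullˡ p ∙ assoc _ _ _

  cover-resp-≈ : ∀ {A B} {f g : A ⇒ B} → f ≈ g → Cover f → Cover g
  cover-resp-≈ f≈g f-cover m k m-mono p = f-cover m k m-mono (p ∙ Eq.sym f≈g)

  cover-cancel : ∀ {A B C} {g : B ⇒ C} (f : A ⇒ B) → Cover (g ∘ f) → Cover g
  cover-cancel f gf-cover m k m-mono p = gf-cover m (k ∘ f) m-mono (pullˡ p)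

  iso⇒cover : ∀ {A B} {f : A ⇒ B} → IsIso f → Cover f
  iso⇒cover f-iso m k m-mono p = record
    { inv  = k ∘ inv
    ; invˡ = m-mono _ _ (pullˡ (pullˡ p ∙ invʳ) ∙ identityˡ _ ∙ Eq.sym (identityʳ _))
    ; invʳ = pullˡ p ∙ invʳ
    }
    where open IsIso f-iso

module PullbackLemmas {o ℓ e} (𝓒 : Category o ℓ e) (pullback : HasPullbacks 𝓒) where
  open Category 𝓒
  open Morphisms 𝓒
  open WithPullbacks 𝓒 pullback
  open CategoryLemmas 𝓒

  square : ∀ {A B X} (f : A ⇒ X) (g : B ⇒ X) → f ∘ π₁ f g ≈ g ∘ π₂ f g
  square f g = Pullback.commute (pullback f g)

  module _ {A B X Z} {f : A ⇒ X} {g : B ⇒ X} {a : Z ⇒ A} {b : Z ⇒ B} {p : f ∘ a ≈ g ∘ b} where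

    π₁-pair : π₁ f g ∘ pair f g a b p ≈ a
    π₁-pair = Pullback.proj₁-∘ (pullback f g) a b p

    π₂-pair : π₂ f g ∘ pair f g a b p ≈ b
    π₂-pair = Pullback.proj₂-∘ (pullback f g) a b p

  joint-mono : ∀ {A B X Z} {f : A ⇒ X} {g : B ⇒ X} {u v : Z ⇒ f ×ₚ g} →
               π₁ f g ∘ u ≈ π₁ f g ∘ v → π₂ f g ∘ u ≈ π₂ f g ∘ v → u ≈ v
  joint-mono {f = f} {g} = Pullback.unique (pullback f g) _ _

  pair-unique : ∀ {A B X Z} {f : A ⇒ X} {g : B ⇒ X} {a : Z ⇒ A} {b : Z ⇒ B}
                {p : f ∘ a ≈ g ∘ b} {u : Z ⇒ f ×ₚ g} →
                π₁ f g ∘ u ≈ a → π₂ f g ∘ u ≈ b → u ≈ pair f g a b p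
  pair-unique p q = joint-mono (p ∙ Eq.sym π₁-pair) (q ∙ Eq.sym π₂-pair)

  pair-cong : ∀ {A B X Z} {f : A ⇒ X} {g : B ⇒ X} {a a′ : Z ⇒ A} {b b′ : Z ⇒ B}
              {p : f ∘ a ≈ g ∘ b} {q : f ∘ a′ ≈ g ∘ b′} →
              a ≈ a′ → b ≈ b′ → pair f g a b p ≈ pair f g a′ b′ q
  pair-cong p q = pair-unique (π₁-pair ∙ p) (π₂-pair ∙ q)

  -- Covers are orthogonal to monos: the pullback of `m` along `u` is a mono through which the cover
  -- `c` factors, hence invertible, and its inverse followed by the other projection is the lift.
  cover-lift : ∀ {S T M D} {c : S ⇒ T} {m : M ⇒ D} {u : T ⇒ D} {v : S ⇒ M} →
               Cover c → Mono m → m ∘ v ≈ u ∘ c → Σ[ w ∈ T ⇒ M ] m ∘ w ≈ u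
  cover-lift {c = c} {m} {u} {v} c-cover m-mono p =
    π₂ u m ∘ inv , pullˡ (Eq.sym (square u m)) ∙ assoc _ _ _ ∙ ∘-congˡ invʳ ∙ identityʳ _
    where
      m-sub : Subobject _
      m-sub = record { arr = m ; mono = m-mono }

      π₁-iso : IsIso (π₁ u m)
      π₁-iso = c-cover (π₁ u m) (pair u m c v (Eq.sym p)) (Subobject.mono (u ^* m-sub)) π₁-pair

      open IsIso π₁-iso

  -- If `g ∘ f` factors through a mono, then so does `g`, by orthogonality to the cover `f`; as `g`
  -- is a cover, the mono is invertible.
  cover-∘ : ∀ {A B C} {g : B ⇒ C} {f : A ⇒ B} → Cover g → Cover f → Cover (g ∘ f)
  cover-∘ g-cover f-cover m k m-mono p =
    let w , mw≈g = cover-lift f-cover m-mono p in g-cover m w m-mono mw≈g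

-- Closure properties of small maps.

module SmallLemmas {o ℓ e s} (𝓔 : PredicativeCategoryWithSmallMaps o ℓ e s) where
  open PredicativeCategoryWithSmallMaps 𝓔
  open IsClassOfSmallMaps isClassOfSmallMaps
  open CategoryLemmas category
  open PullbackLemmas category pullback

  -- A section of `f` defined only after base change along the cover `κ` suffices, since the cover
  -- `π₁ t κ` then factors through `f`.
  cover-locally : ∀ {K L T S} {κ : K ⇒ L} (t : T ⇒ L) {f : S ⇒ T} →
                  Cover κ → (s : t ×ₚ κ ⇒ S) → f ∘ s ≈ π₁ t κ → Cover f
  cover-locally t κ-cover s p =
    cover-cancel s (cover-resp-≈ (Eq.sym p) (cover-stable t _ κ-cover))

  small-π₁ : ∀ {A B X} (f : A ⇒ X) {g : B ⇒ X} → Small g → Small (π₁ f g)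
  small-π₁ f {g} = pullback-stable (Pullback.isPullback (pullback f g))

  -- With identities as the other two sides of the square, `g` is a pullback of `f`.
  small-resp-≈ : ∀ {A B} {f g : A ⇒ B} → f ≈ g → Small f → Small g
  small-resp-≈ f≈g = pullback-stable {p = id} {d = id} record
    { commute   = identityˡ _ ∙ Eq.sym f≈g ∙ Eq.sym (identityʳ _)
    ; universal = λ a b p → b
    ; proj₁-∘   = λ a b p → ∘-congʳ (Eq.sym f≈g) ∙ Eq.sym p ∙ identityˡ _
    ; proj₂-∘   = λ a b p → identityˡ _
    ; unique    = λ u v p q → Eq.sym (identityˡ _) ∙ q ∙ identityˡ _
    }

  -- f is the composite of its graph, a pullback of a diagonal, with a pullback of g ∘ f.
  small-cancel : ∀ {A B C} (g : B ⇒ C) {f : A ⇒ B} → Small (g ∘ f) → Small f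
  small-cancel g {f} gf-small =
    small-resp-≈ π₁-pair (composition (small-π₁ g gf-small) (pullback-stable graph diagonals))
    where
      p₁ = π₁ g (g ∘ f)
      p₂ = π₂ g (g ∘ f)

      graph : IsPullback (pair g (g ∘ f) f id (Eq.sym (identityʳ _))) f
                         ⟨ p₁ , f ∘ p₂ ⟩ ⟨ id , id ⟩
      graph = record
        { commute   = joint-mono
            (pullˡ π₁-pair ∙ π₁-pair ∙ Eq.sym (pullˡ π₁-pair ∙ identityˡ _))
            (pullˡ π₂-pair ∙ assoc _ _ _ ∙ ∘-congˡ π₂-pair ∙ identityʳ _
              ∙ Eq.sym (pullˡ π₂-pair ∙ identityˡ _))
        ; universal = λ a b p → p₂ ∘ a
        ; proj₁-∘   = λ a b p → joint-mono
            (pullˡ π₁-pair ∙ second p ∙ Eq.sym (first p))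
            (pullˡ π₂-pair ∙ identityˡ _)
        ; proj₂-∘   = λ a b p → second p
        ; unique    = λ u v p q →
            Eq.sym (pullˡ π₂-pair ∙ identityˡ _) ∙ ∘-congˡ p ∙ pullˡ π₂-pair ∙ identityˡ _
        }
        where
          module _ {Z} {a : Z ⇒ _} {b : Z ⇒ _}
                   (p : ⟨ p₁ , f ∘ p₂ ⟩ ∘ a ≈ ⟨ id , id ⟩ ∘ b) where
            first : p₁ ∘ a ≈ b
            first = Eq.sym (pullˡ π₁-pair) ∙ ∘-congˡ p ∙ pullˡ π₁-pair ∙ identityˡ _

            second : f ∘ (p₂ ∘ a) ≈ b
            second = Eq.sym (assoc _ _ _) ∙ Eq.sym (pullˡ π₂-pair) ∙ ∘-congˡ p
              ∙ pullˡ π₂-pair ∙ identityˡ _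

-- Multi-valued sections and refinements in terms of generalized elements.

-- The composites φ : B → A → X and Y → X′ → X appear as variables β and qy, equal to
-- them only propositionally.  In Psh, conversion would otherwise unfold the composites
-- inside pullback presheaves, which is infeasible.
module Generalized {o ℓ e s} (𝓒 : Category o ℓ e) (pullback : HasPullbacks 𝓒)
                   (Small : ∀ {A B} → Category._⇒_ 𝓒 A B → Set s) where
  open Category 𝓒
  open Morphisms 𝓒
  open WithPullbacks 𝓒 pullback
  open FullnessAxiom 𝓒 pullback Small
  open CategoryLemmas 𝓒
  open PullbackLemmas 𝓒 pullback
  private
    module S = Subobject

  -- `proj` is a field, determined up to `≈` by its two components, because `fibreMap` starts at
  -- `y ×ₚ (α ∘ φ)` and not at `y ×ₚ β`.
  record Mvs′ {X Y A B} (φ : B ⇒ A) (α : A ⇒ X) (β : B ⇒ X) (y : Y ⇒ X) : Set (o ⊔ ℓ ⊔ e ⊔ s) where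
    field
      sub     : Subobject (y ×ₚ β)
      proj    : S.dom sub ⇒ y ×ₚ α
      π₁-proj : π₁ y α ∘ proj ≈ π₁ y β ∘ S.arr sub
      π₂-proj : π₂ y α ∘ proj ≈ φ ∘ (π₂ y β ∘ S.arr sub)
      cover   : Cover proj
      small   : Small proj

    index : S.dom sub ⇒ Y
    index = π₁ y β ∘ S.arr sub

    value : S.dom sub ⇒ B
    value = π₂ y β ∘ S.arr sub

  -- `below` expresses the inclusion of `k^*P` in `l^*Q` by elements: an element of `P` over `k ∘ u`
  -- has a counterpart in `Q` over `l ∘ u` with the same value.
  record Refines′ {X X′ Y Z A B} {φ : B ⇒ A} {α : A ⇒ X} {β : B ⇒ X}
                  (y : Y ⇒ X′) {qy : Y ⇒ X} (P : Mvs′ φ α β qy)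
                  (z : Z ⇒ X′) {qz : Z ⇒ X} (Q : Mvs′ φ α β qz) : Set (o ⊔ ℓ ⊔ e ⊔ s) where
    private
      module P = Mvs′ P
      module Q = Mvs′ Q
    field
      {U}     : Obj
      k       : U ⇒ Y
      l       : U ⇒ Z
      l-cover : Cover l
      commute : y ∘ k ≈ z ∘ l
      below   : ∀ {T} (u : T ⇒ U) (p : T ⇒ S.dom P.sub) → P.index ∘ p ≈ k ∘ u →
                Σ[ r ∈ T ⇒ S.dom Q.sub ] (Q.index ∘ r ≈ l ∘ u × Q.value ∘ r ≈ P.value ∘ p)

  record GenericMvs′ {X A B} (φ : B ⇒ A) (α : A ⇒ X) (β : B ⇒ X) : Set (o ⊔ ℓ ⊔ e ⊔ s) where
    field
      {X′ Y}  : Obj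
      q       : X′ ⇒ X
      q-cover : Cover q
      y       : Y ⇒ X′
      y-small : Small y
      qy      : Y ⇒ X
      qy≡     : qy ≡ q ∘ y
      P       : Mvs′ φ α β qy
      generic : ∀ {Z} (z : Z ⇒ X′) {qz : Z ⇒ X} → qz ≡ q ∘ z → (Q : Mvs′ φ α β qz) →
                Refines′ y P z Q

  -- The elementwise content of k^*P ≤ l^*Q.
  module _ {X X′ Y Z A B} {φ : B ⇒ A} {α : A ⇒ X} {q : X′ ⇒ X} {y : Y ⇒ X′} {z : Z ⇒ X′}
           {P : Mvs φ α (q ∘ y)} {Q : Mvs φ α (q ∘ z)} (R : Refines φ α q y P z Q) where
    private
      open Refines R
      αφ = α ∘ φ
      Pa = S.arr (Mvs.sub P)
      Qa = S.arr (Mvs.sub Q)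
      bk = baseChange (q ∘ y) αφ k Eq.refl
      bl = baseChange (q ∘ z) αφ l (whisker q y z k l commute)

    below-elements : ∀ {T} (u : T ⇒ U) (p : T ⇒ S.dom (Mvs.sub P)) →
      π₁ (q ∘ y) αφ ∘ (Pa ∘ p) ≈ k ∘ u →
      Σ[ r ∈ T ⇒ S.dom (Mvs.sub Q) ]
        (π₁ (q ∘ z) αφ ∘ (Qa ∘ r) ≈ l ∘ u ×
         π₂ (q ∘ z) αφ ∘ (Qa ∘ r) ≈ π₂ (q ∘ y) αφ ∘ (Pa ∘ p))
    below-elements {T} u p p-u = π₂ bl Qa ∘ r
      , (∘-congˡ Qa-r ∙ pullˡ π₁-pair ∙ assoc _ _ _ ∙ ∘-congˡ π₁-pair)
      , (∘-congˡ Qa-r ∙ pullˡ π₂-pair ∙ π₂-pair)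
      where
        t : T ⇒ ((q ∘ y) ∘ k) ×ₚ αφ
        t = pair ((q ∘ y) ∘ k) αφ u (π₂ (q ∘ y) αφ ∘ (Pa ∘ p))
          (assoc _ _ _ ∙ ∘-congˡ (Eq.sym p-u) ∙ extend (square (q ∘ y) αφ))

        bk-t : bk ∘ t ≈ Pa ∘ p
        bk-t = joint-mono
          (pullˡ π₁-pair ∙ assoc _ _ _ ∙ ∘-congˡ π₁-pair ∙ Eq.sym p-u)
          (pullˡ π₂-pair ∙ π₂-pair)

        r : T ⇒ bl ×ₚ Qa
        r = proj₁ below ∘ pair bk Pa t p bk-t

        Qa-r : Qa ∘ (π₂ bl Qa ∘ r) ≈ bl ∘ t
        Qa-r = extend (Eq.sym (square bl Qa)) ∙ ∘-congˡ (pullˡ (proj₂ below) ∙ π₁-pair)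

  module _ (small-resp : ∀ {A B} {f g : A ⇒ B} → f ≈ g → Small f → Small g)
           {X A B} {φ : B ⇒ A} {α : A ⇒ X} where

    Mvs′⇒Mvs : ∀ {Y} {y : Y ⇒ X} → Mvs′ φ α (α ∘ φ) y → Mvs φ α y
    Mvs′⇒Mvs {y = y} P = record
      { sub   = sub
      ; cover = cover-resp-≈ proj≈ cover
      ; small = small-resp proj≈ small
      }
      where
        open Mvs′ P
        proj≈ : proj ≈ fibreMap y φ α ∘ S.arr sub
        proj≈ = joint-mono
          (π₁-proj ∙ Eq.sym (pullˡ π₁-pair))
          (π₂-proj ∙ Eq.sym (pullˡ π₂-pair ∙ assoc _ _ _))

    Mvs⇒Mvs′ : ∀ {Y} {y : Y ⇒ X} → Mvs φ α y → Mvs′ φ α (α ∘ φ) y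
    Mvs⇒Mvs′ {y = y} Q = record
      { sub     = sub
      ; proj    = fibreMap y φ α ∘ S.arr sub
      ; π₁-proj = pullˡ π₁-pair
      ; π₂-proj = pullˡ π₂-pair ∙ assoc _ _ _
      ; cover   = cover
      ; small   = small
      }
      where open Mvs Q

    -- The inclusion is `below` evaluated at the generic element, that is, at the domain of `k^*P`
    -- with its two projections.
    Refines′⇒Refines : ∀ {X′ Y Z} {q : X′ ⇒ X} {y : Y ⇒ X′} {z : Z ⇒ X′}
                       (P : Mvs′ φ α (α ∘ φ) (q ∘ y)) (Q : Mvs φ α (q ∘ z)) →
                       Refines′ y P z (Mvs⇒Mvs′ Q) → Refines φ α q y (Mvs′⇒Mvs P) z Q
    Refines′⇒Refines {q = q} {y} {z} P Q R = record
      { k       = k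
      ; l       = l
      ; l-cover = l-cover
      ; commute = commute
      ; below   = pair bl Qa P* (proj₁ el) (joint-mono
          (pullˡ π₁-pair ∙ assoc _ _ _ ∙ Eq.sym (Eq.sym (assoc _ _ _) ∙ proj₁ (proj₂ el)))
          (pullˡ π₂-pair ∙ value≈ ∙ Eq.sym (Eq.sym (assoc _ _ _) ∙ proj₂ (proj₂ el))))
        , π₁-pair
      }
      where
        open Refines′ R
        αφ = α ∘ φ
        Pa = S.arr (Mvs′.sub P)
        Qa = S.arr (Mvs.sub Q)
        bk = baseChange (q ∘ y) αφ k Eq.refl
        bl = baseChange (q ∘ z) αφ l (whisker q y z k l commute)
        P* = π₁ bk Pa
        u  = π₁ ((q ∘ y) ∘ k) αφ ∘ P*

        over-k : (π₁ (q ∘ y) αφ ∘ Pa) ∘ π₂ bk Pa ≈ k ∘ u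
        over-k = assoc _ _ _ ∙ ∘-congˡ (Eq.sym (square bk Pa)) ∙ pullˡ π₁-pair ∙ assoc _ _ _

        value≈ : π₂ ((q ∘ y) ∘ k) αφ ∘ P* ≈ (π₂ (q ∘ y) αφ ∘ Pa) ∘ π₂ bk Pa
        value≈ = Eq.sym (assoc _ _ _ ∙ ∘-congˡ (Eq.sym (square bk Pa)) ∙ pullˡ π₂-pair)

        el = below u (π₂ bk Pa) over-k

    GenericMvs′⇒GenericMvs : ∀ {β : B ⇒ X} → β ≡ α ∘ φ → GenericMvs′ φ α β → GenericMvs φ α
    GenericMvs′⇒GenericMvs refl record
      { q = q ; q-cover = q-cover ; y = y ; y-small = y-small ; qy≡ = refl ; P = P ; generic = generic } =
      record
      { q       = q
      ; q-cover = q-cover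
      ; y       = y
      ; y-small = y-small
      ; P       = Mvs′⇒Mvs P
      ; generic = λ z Q → Refines′⇒Refines P Q (generic z refl (Mvs⇒Mvs′ Q))
      }

-- Monos, covers, subpresheaves and free presheaves.

module PresheafLemmas {o ℓ e} (𝓒 : Category o ℓ e) (pullback : HasPullbacks 𝓒)
                      (ℂ : InternalCategory 𝓒 pullback) where
  open Category 𝓒
  open Morphisms 𝓒
  open WithPullbacks 𝓒 pullback
  open CategoryLemmas 𝓒
  open PullbackLemmas 𝓒 pullback
  open InternalCategory ℂ
  open Presheaves 𝓒 pullback ℂ
  open HomReasoning
  private
    module PM = Morphisms Psh

  cod-⊙ : ∀ {T} {f g : T ⇒ C₁} {p : dom ∘ f ≈ cod ∘ g} → cod ∘ (f ⊙ g [ p ]) ≈ cod ∘ f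
  cod-⊙ = pullˡ cod-comp ∙ assoc _ _ _ ∙ ∘-congˡ π₁-pair

  dom-⊙ : ∀ {T} {f g : T ⇒ C₁} {p : dom ∘ f ≈ cod ∘ g} → dom ∘ (f ⊙ g [ p ]) ≈ dom ∘ g
  dom-⊙ = pullˡ dom-comp ∙ assoc _ _ _ ∙ ∘-congˡ π₂-pair

  ⊙-cong : ∀ {T} {f f′ g g′ : T ⇒ C₁} {p : dom ∘ f ≈ cod ∘ g} {p′ : dom ∘ f′ ≈ cod ∘ g′} →
           f ≈ f′ → g ≈ g′ → f ⊙ g [ p ] ≈ f′ ⊙ g′ [ p′ ]
  ⊙-cong p q = ∘-congˡ (pair-cong p q)

  ⊙-∘ : ∀ {T S} {f g : T ⇒ C₁} {p : dom ∘ f ≈ cod ∘ g} (t : S ⇒ T)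
        {q : dom ∘ (f ∘ t) ≈ cod ∘ (g ∘ t)} →
        (f ⊙ g [ p ]) ∘ t ≈ (f ∘ t) ⊙ (g ∘ t) [ q ]
  ⊙-∘ t = assoc _ _ _ ∙ ∘-congˡ (pair-unique (pullˡ π₁-pair) (pullˡ π₂-pair))

  module _ (X : Presheaf) where
    open Presheaf X

    act-· : ∀ {T} (t : T ⇒ π ×ₚ cod) →
            act ∘ t ≈ (elt ∘ t) · mor ∘ t [ extend elt-mor ]
    act-· t = ∘-congˡ (pair-unique Eq.refl Eq.refl)

    ·-idn : ∀ {T} (x : T ⇒ obj) {f : T ⇒ C₁} {p : π ∘ x ≈ cod ∘ f} →
            f ≈ idn ∘ (π ∘ x) → x · f [ p ] ≈ x
    ·-idn x {p = p} q = ·-cong Eq.refl q ∙ act-idn x (p ∙ ∘-congˡ q)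

    ·-· : ∀ {T} {x : T ⇒ obj} {f g : T ⇒ C₁} {p : π ∘ x ≈ cod ∘ f}
          {q : π ∘ (x · f [ p ]) ≈ cod ∘ g} {r : dom ∘ f ≈ cod ∘ g}
          {s : π ∘ x ≈ cod ∘ (f ⊙ g [ r ])} →
          (x · f [ p ]) · g [ q ] ≈ x · f ⊙ g [ r ] [ s ]
    ·-· = act-⊙ _ _ _ _ _ _ _

  module _ {X Y : Presheaf} (u : PshHom X Y) where
    private
      module X = Presheaf X
      module Y = Presheaf Y
    open PshHom u

    over-∘ : ∀ {T} {x : T ⇒ X.obj} {c : T ⇒ C₀} → X.π ∘ x ≈ c → Y.π ∘ (arr ∘ x) ≈ c
    over-∘ p = pullˡ over ∙ p

    hom-· : ∀ {T} {x : T ⇒ X.obj} {f : T ⇒ C₁}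
            {p : X.π ∘ x ≈ cod ∘ f} {q : Y.π ∘ (arr ∘ x) ≈ cod ∘ f} →
            arr ∘ (x X.· f [ p ]) ≈ (arr ∘ x) Y.· f [ q ]
    hom-· = equivariant-elt _ _ _ _

  open Presheaf
  open PshHom

  -- Equivariance of `w` may be tested after composing with the mono `m`, where it becomes
  -- equivariance of `u`.
  corestrict : ∀ {S I Y : Presheaf} (m : PshHom I Y) → Mono (arr m) → (u : PshHom S Y) →
               (w : obj S ⇒ obj I) → arr m ∘ w ≈ arr u → PshHom S I
  corestrict {S} {I} {Y} m m-mono u w p = record
    { arr         = w
    ; over        = w-over
    ; equivariant = m-mono _ _ (begin
        arr m ∘ (w ∘ act S)                       ≈⟨ pullˡ p ⟩
        arr u ∘ act S                             ≈⟨ equivariant u ⟩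
        _·_[_] Y (arr u ∘ elt S) (mor S) _        ≈⟨ ·-cong Y (Eq.sym (pullˡ p)) Eq.refl ⟩
        _·_[_] Y (arr m ∘ (w ∘ elt S)) (mor S) (over-∘ m w-elt) ≈⟨ Eq.sym (hom-· m) ⟩
        arr m ∘ (_·_[_] I (w ∘ elt S) (mor S) w-elt) ∎)
    }
    where
      w-over : π I ∘ w ≈ π S
      w-over = ∘-congʳ (Eq.sym (over m)) ∙ assoc _ _ _ ∙ ∘-congˡ p ∙ over u

      w-elt : π I ∘ (w ∘ elt S) ≈ cod ∘ mor S
      w-elt = pullˡ w-over ∙ elt-mor S

  mono⇒Psh-mono : ∀ {X Y} {m : PshHom X Y} → Mono (arr m) → PM.Mono m
  mono⇒Psh-mono m-mono u v = m-mono (arr u) (arr v)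

  -- Pullbacks of presheaves are computed on underlying objects, so the kernel pair of `m` in `Psh`
  -- is that of `arr m`; its projections agree as `m` is mono.
  Psh-mono⇒mono : ∀ {X Y} {m : PshHom X Y} → PM.Mono m → Mono (arr m)
  Psh-mono⇒mono {m = m} m-mono u v p =
    Eq.sym π₁-pair ∙ ∘-congʳ (m-mono K.p₁ K.p₂ K.commute) ∙ π₂-pair {p = p}
    where module K = PM.Pullback (Psh-pullbacks m m)

  -- A mono of presheaves is mono on underlying objects, so it is inverted there, and the inverse is
  -- equivariant by `corestrict`.
  cover⇒Psh-cover : ∀ {X Y} {f : PshHom X Y} → Cover (arr f) → PM.Cover f
  cover⇒Psh-cover {Y = Y} f-cover m k m-mono p = record
    { inv  = corestrict m arr-mono (Category.id Psh) inv invʳ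
    ; invˡ = invˡ
    ; invʳ = invʳ
    }
    where
      arr-mono = Psh-mono⇒mono {m = m} m-mono
      open IsIso (f-cover (arr m) (arr k) arr-mono p)

  module _ {Y : Presheaf} {I : Obj} (m : I ⇒ obj Y) (m-mono : Mono m) where
    private
      module Y = Presheaf Y

      πI : I ⇒ C₀
      πI = Y.π ∘ m

      elt-morI : Y.π ∘ (m ∘ π₁ πI cod) ≈ cod ∘ π₂ πI cod
      elt-morI = Eq.sym (assoc _ _ _) ∙ square πI cod

    module _ (actI : πI ×ₚ cod ⇒ I)
             (m-act : m ∘ actI ≈ (m ∘ π₁ πI cod) Y.· π₂ πI cod [ elt-morI ]) where
      private
        m-· : ∀ {T} {x : T ⇒ I} {f : T ⇒ C₁} {p : πI ∘ x ≈ cod ∘ f}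
              {q : Y.π ∘ (m ∘ x) ≈ cod ∘ f} →
              m ∘ (actI ∘ pair πI cod x f p) ≈ (m ∘ x) Y.· f [ q ]
        m-· {p = p} = pullˡ m-act ∙ Y.·-∘ _ {q = ∘-congˡ m-x ∙ Eq.sym (assoc _ _ _) ∙ p ∙ ∘-congˡ (Eq.sym π₂-pair)}
          ∙ Y.·-cong m-x π₂-pair
          where m-x = assoc _ _ _ ∙ ∘-congˡ π₁-pair

      -- A subobject closed under the action inherits the action laws, as they may be tested in `Y`
      -- after composing with the mono `m`.
      subpresheaf : Presheaf
      subpresheaf = record
        { π       = πI
        ; act     = actI
        ; act-dom = assoc _ _ _ ∙ ∘-congˡ m-act ∙ Y.π-· _ _ _
        ; act-idn = λ x p → m-mono _ _
            (m-· {q = Eq.sym (assoc _ _ _) ∙ p} ∙ ·-idn Y _ (∘-congˡ (assoc _ _ _)))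
        ; act-⊙   = λ x f g p q r s → m-mono _ _
            (m-· {q = Eq.sym (assoc _ _ _) ∙ q}
              ∙ Y.·-cong (m-· {q = Eq.sym (assoc _ _ _) ∙ p}) Eq.refl
              ∙ ·-· Y {q = Y.π-· _ _ _ ∙ r} ∙ Eq.sym (m-· {q = Eq.sym (assoc _ _ _) ∙ s}))
        }

      subpresheaf-arr : PshHom subpresheaf Y
      subpresheaf-arr = record { arr = m ; over = Eq.refl ; equivariant = m-act ∙ Y.·-cong Eq.refl Eq.refl }

  module _ (V : Obj) (v : V ⇒ C₀) where
    private
      F : Obj
      F = v ×ₚ cod

      ϖ : F ⇒ C₀
      ϖ = dom ∘ π₂ v cod

      e₁ : ϖ ×ₚ cod ⇒ F
      e₁ = π₁ ϖ cod

      comp-e : dom ∘ (π₂ v cod ∘ e₁) ≈ cod ∘ π₂ ϖ cod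
      comp-e = Eq.sym (assoc _ _ _) ∙ square ϖ cod

      actF : ϖ ×ₚ cod ⇒ F
      actF = pair v cod (π₁ v cod ∘ e₁) ((π₂ v cod ∘ e₁) ⊙ π₂ ϖ cod [ comp-e ])
        (extend (square v cod) ∙ Eq.sym cod-⊙)

      module _ {T} {x : T ⇒ F} {f : T ⇒ C₁} {p : ϖ ∘ x ≈ cod ∘ f} where
        act₁ : π₁ v cod ∘ (actF ∘ pair ϖ cod x f p) ≈ π₁ v cod ∘ x
        act₁ = pullˡ π₁-pair ∙ assoc _ _ _ ∙ ∘-congˡ π₁-pair

        act₂ : {q : dom ∘ (π₂ v cod ∘ x) ≈ cod ∘ f} →
               π₂ v cod ∘ (actF ∘ pair ϖ cod x f p) ≈ (π₂ v cod ∘ x) ⊙ f [ q ]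
        act₂ {q} = pullˡ π₂-pair
          ∙ ⊙-∘ _ {∘-congˡ x≈ ∙ q ∙ ∘-congˡ (Eq.sym π₂-pair)} ∙ ⊙-cong x≈ π₂-pair
          where x≈ = assoc _ _ _ ∙ ∘-congˡ π₁-pair

    -- The left adjoint of the forgetful functor to the slice over `C₀`, acting by composition in
    -- the arrow component; `η` is the unit and `_♯` the transpose.
    free : Presheaf
    free = record
      { π       = ϖ
      ; act     = actF
      ; act-dom = assoc _ _ _ ∙ ∘-congˡ π₂-pair ∙ dom-⊙
      ; act-idn = λ x p → joint-mono act₁
          (act₂ {q = Eq.sym (assoc _ _ _) ∙ p}
            ∙ ⊙-cong {p′ = Eq.sym (assoc _ _ _) ∙ p ∙ ∘-congˡ (∘-congˡ (assoc _ _ _))}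
                Eq.refl (∘-congˡ (assoc _ _ _))
            ∙ identityʳ-⊙ _ _)
      ; act-⊙   = λ x f g p q r s →
          let q₁ : dom ∘ (π₂ v cod ∘ x) ≈ cod ∘ f
              q₁ = Eq.sym (assoc _ _ _) ∙ p
          in joint-mono (act₁ ∙ act₁ ∙ Eq.sym act₁)
          (act₂ {q = Eq.sym (assoc _ _ _) ∙ q}
            ∙ ⊙-cong {p′ = dom-⊙ ∙ r} (act₂ {q = q₁}) Eq.refl
            ∙ assoc-⊙ _ _ _ q₁ r _ (Eq.sym (assoc _ _ _) ∙ s)
            ∙ Eq.sym act₂)
      }

    -- The pair (x , g) stands for x · g, with x a generator.
    gen : F ⇒ V
    gen = π₁ v cod

    arrow : F ⇒ C₁
    arrow = π₂ v cod

    arrow-· : ∀ {T} {x : T ⇒ F} {f : T ⇒ C₁} {p : ϖ ∘ x ≈ cod ∘ f}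
              {q : dom ∘ (arrow ∘ x) ≈ cod ∘ f} →
              arrow ∘ (_·_[_] free x f p) ≈ (arrow ∘ x) ⊙ f [ q ]
    arrow-· = act₂

    gen-· : ∀ {T} {x : T ⇒ F} {f : T ⇒ C₁} {p : ϖ ∘ x ≈ cod ∘ f} →
            gen ∘ (_·_[_] free x f p) ≈ gen ∘ x
    gen-· = act₁

    private
      η-eq : v ∘ id ≈ cod ∘ (idn ∘ v)
      η-eq = identityʳ _ ∙ Eq.sym (pullˡ cod-idn ∙ identityˡ _)

    η : V ⇒ F
    η = pair v cod id (idn ∘ v) η-eq

    π-η : ϖ ∘ η ≈ v
    π-η = assoc _ _ _ ∙ ∘-congˡ π₂-pair ∙ pullˡ dom-idn ∙ identityˡ _

    module _ (X : Presheaf) (r : V ⇒ obj X) (r-over : π X ∘ r ≈ v) where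
      private
        module X = Presheaf X

        elt-mor♯ : X.π ∘ (r ∘ gen) ≈ cod ∘ arrow
        elt-mor♯ = pullˡ r-over ∙ square v cod

        r♯ : F ⇒ X.obj
        r♯ = (r ∘ gen) X.· arrow [ elt-mor♯ ]

        r♯-∘ : ∀ {T} (t : T ⇒ F) {q : X.π ∘ (r ∘ (gen ∘ t)) ≈ cod ∘ (arrow ∘ t)} →
               r♯ ∘ t ≈ (r ∘ (gen ∘ t)) X.· arrow ∘ t [ q ]
        r♯-∘ t {q} = X.·-∘ t {∘-congˡ (assoc _ _ _) ∙ q} ∙ X.·-cong (assoc _ _ _) Eq.refl

      _♯ : PshHom free X
      _♯ = record
        { arr         = r♯
        ; over        = X.π-· _ _ _
        ; equivariant = r♯-∘ actF {pullˡ r-over ∙ extend (square v cod)}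
            ∙ X.·-cong (∘-congˡ π₁-pair) π₂-pair
            ∙ Eq.sym (·-· X {p = pullˡ r-over ∙ extend (square v cod)} {q = X.π-· _ _ _ ∙ comp-e} {r = comp-e}
                            {s = pullˡ r-over ∙ extend (square v cod) ∙ Eq.sym cod-⊙})
            ∙ X.·-cong (Eq.sym (r♯-∘ e₁)) Eq.refl
        }

      ♯-∘ : ∀ {T} (t : T ⇒ F) {q : X.π ∘ (r ∘ (gen ∘ t)) ≈ cod ∘ (arrow ∘ t)} →
            arr _♯ ∘ t ≈ (r ∘ (gen ∘ t)) X.· arrow ∘ t [ q ]
      ♯-∘ t = r♯-∘ t

      ♯-η : arr _♯ ∘ η ≈ r
      ♯-η = r♯-∘ η {pullˡ r-over ∙ extend (square v cod)}
        ∙ X.·-cong {q = r-over ∙ Eq.sym (pullˡ cod-idn ∙ identityˡ _)} (∘-congˡ π₁-pair ∙ identityʳ _) π₂-pair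
        ∙ ·-idn X r (∘-congˡ (Eq.sym r-over))

    module _ {X : Presheaf} where
      private
        module X = Presheaf X
        -- Every element `(x , g)` equals `η x · g`, so equivariance determines `u` from its values
        -- on generators.
        decompose : (u : PshHom free X) →
                    arr u ≈ ((arr u ∘ η) ∘ gen) X.· arrow
                      [ ∘-congˡ (assoc _ _ _) ∙ over-∘ u (pullˡ π-η ∙ square v cod) ]
        decompose u = begin
          arr u                               ≈⟨ Eq.sym (identityʳ _) ⟩
          arr u ∘ id                          ≈⟨ ∘-congˡ (Eq.sym η-·) ⟩
          arr u ∘ _·_[_] free (η ∘ gen) arrow (pullˡ π-η ∙ square v cod)   ≈⟨ hom-· u {q = over-∘ u (pullˡ π-η ∙ square v cod)} ⟩
          (arr u ∘ (η ∘ gen)) X.· arrow [ _ ] ≈⟨ X.·-cong (Eq.sym (assoc _ _ _)) Eq.refl ⟩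
          ((arr u ∘ η) ∘ gen) X.· arrow [ _ ] ∎
          where
            idn≈ : arrow ∘ (η ∘ gen) ≈ idn ∘ (cod ∘ arrow)
            idn≈ = pullˡ π₂-pair ∙ assoc _ _ _ ∙ ∘-congˡ (square v cod)

            r : dom ∘ (idn ∘ (cod ∘ arrow)) ≈ cod ∘ arrow
            r = pullˡ dom-idn ∙ identityˡ _

            η-· : _·_[_] free (η ∘ gen) arrow (pullˡ π-η ∙ square v cod) ≈ id
            η-· = joint-mono
              (gen-· ∙ pullˡ π₁-pair ∙ identityˡ _ ∙ Eq.sym (identityʳ _))
              (arrow-· {q = ∘-congˡ idn≈ ∙ r} ∙ ⊙-cong {p′ = r} idn≈ Eq.refl
                ∙ identityˡ-⊙ _ _ ∙ Eq.sym (identityʳ _))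

      free-ext : {u v : PshHom free X} → arr u ∘ η ≈ arr v ∘ η → arr u ≈ arr v
      free-ext {u} {v} p =
        decompose u ∙ X.·-cong (∘-congʳ p) Eq.refl ∙ Eq.sym (decompose v)

  module _ {V V′ : Obj} {v : V ⇒ C₀} {v′ : V′ ⇒ C₀} (r : V ⇒ V′) (r-over : v′ ∘ r ≈ v) where
    private
      η-r-over : π (free V′ v′) ∘ (η V′ v′ ∘ r) ≈ v
      η-r-over = pullˡ (π-η V′ v′) ∙ r-over

    freeMap : PshHom (free V v) (free V′ v′)
    freeMap = _♯ V v (free V′ v′) (η V′ v′ ∘ r) η-r-over

    gen-freeMap : gen V′ v′ ∘ arr freeMap ≈ r ∘ gen V v
    gen-freeMap = gen-· V′ v′ ∙ ∘-congˡ (assoc _ _ _) ∙ pullˡ π₁-pair ∙ identityˡ _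

    arrow-freeMap : arrow V′ v′ ∘ arr freeMap ≈ arrow V v
    arrow-freeMap = arrow-· V′ v′ {q = eq} ∙ ⊙-cong {p′ = q} idn≈ Eq.refl ∙ identityˡ-⊙ _ q
      where
        q : dom ∘ (idn ∘ (cod ∘ arrow V v)) ≈ cod ∘ arrow V v
        q = pullˡ dom-idn ∙ identityˡ _

        idn≈ : arrow V′ v′ ∘ ((η V′ v′ ∘ r) ∘ gen V v) ≈ idn ∘ (cod ∘ arrow V v)
        idn≈ = ∘-congˡ (assoc _ _ _) ∙ pullˡ π₂-pair ∙ assoc _ _ _
          ∙ ∘-congˡ (pullˡ r-over ∙ square v cod)

        eq : dom ∘ (arrow V′ v′ ∘ ((η V′ v′ ∘ r) ∘ gen V v)) ≈ cod ∘ arrow V v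
        eq = ∘-congˡ idn≈ ∙ q

-- Images of presheaf maps, and covers as pointwise covers.

module PresheafImages {o ℓ e s} (𝓔 : PredicativeCategoryWithSmallMaps o ℓ e s)
         (ℂ : InternalCategory (PredicativeCategoryWithSmallMaps.category 𝓔)
                               (PredicativeCategoryWithSmallMaps.pullback 𝓔)) where
  open PredicativeCategoryWithSmallMaps 𝓔
  open CategoryLemmas category
  open PullbackLemmas category pullback
  open InternalCategory ℂ
  open Presheaves category pullback ℂ
  open PresheafLemmas category pullback ℂ
  open Presheaf
  open PshHom
  private
    module PM = Morphisms Psh

  module _ {X Y : Presheaf} (f : PshHom X Y) where
    private
      module X = Presheaf X
      module Y = Presheaf Y
      module I = Subobject (image (arr f))

      c : X.obj ⇒ I.dom
      c = image-cover (arr f)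

      eltI : (Y.π ∘ I.arr) ×ₚ cod ⇒ I.dom
      eltI = π₁ (Y.π ∘ I.arr) cod

      morI : (Y.π ∘ I.arr) ×ₚ cod ⇒ C₁
      morI = π₂ (Y.π ∘ I.arr) cod

      elt-morI : Y.π ∘ (I.arr ∘ eltI) ≈ cod ∘ morI
      elt-morI = Eq.sym (assoc _ _ _) ∙ square _ _

      T : Obj
      T = eltI ×ₚ c

      t₁ : T ⇒ (Y.π ∘ I.arr) ×ₚ cod
      t₁ = π₁ eltI c

      f-t₂ : arr f ∘ π₂ eltI c ≈ (I.arr ∘ eltI) ∘ t₁
      f-t₂ = ∘-congʳ (Eq.sym (image-∘ (arr f))) ∙ assoc _ _ _
        ∙ ∘-congˡ (Eq.sym (square eltI c)) ∙ Eq.sym (assoc _ _ _)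

      Y-elt-mor : Y.π ∘ ((I.arr ∘ eltI) ∘ t₁) ≈ cod ∘ (morI ∘ t₁)
      Y-elt-mor = extend elt-morI

      f-elt-mor : Y.π ∘ (arr f ∘ π₂ eltI c) ≈ cod ∘ (morI ∘ t₁)
      f-elt-mor = ∘-congˡ f-t₂ ∙ Y-elt-mor

      X-elt-mor : X.π ∘ π₂ eltI c ≈ cod ∘ (morI ∘ t₁)
      X-elt-mor = ∘-congʳ (Eq.sym (over f)) ∙ assoc _ _ _ ∙ f-elt-mor

      -- The action descends along the cover of pairs (i , g) by pairs (x , g).
      actI : Σ[ a ∈ (Y.π ∘ I.arr) ×ₚ cod ⇒ I.dom ]
               I.arr ∘ a ≈ (I.arr ∘ eltI) Y.· morI [ elt-morI ]
      actI = cover-lift (cover-stable eltI c (image-isCover (arr f))) I.mono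
        (pullˡ (image-∘ (arr f))
          ∙ hom-· f {x = π₂ eltI c} {p = X-elt-mor} {q = f-elt-mor}
          ∙ Y.·-cong f-t₂ Eq.refl
          ∙ Eq.sym (Y.·-∘ t₁ {q = Y-elt-mor}))

    abstract
      -- Opaque, since conversion checking must not compare image presheaves by unfolding.
      imageSub : PM.Subobject Y
      imageSub = record
        { arr  = subpresheaf-arr {Y} I.arr I.mono (proj₁ actI) (proj₂ actI)
        ; mono = mono⇒Psh-mono {m = subpresheaf-arr {Y} I.arr I.mono (proj₁ actI) (proj₂ actI)} I.mono
        }

      imageCover : PshHom X (PM.Subobject.dom imageSub)
      imageCover = corestrict (PM.Subobject.arr imageSub) I.mono f c (image-∘ (arr f))

      imageCover-∘ : arr (PM.Subobject.arr imageSub) ∘ arr imageCover ≈ arr f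
      imageCover-∘ = image-∘ (arr f)

      imageCover-isCover : Cover (arr imageCover)
      imageCover-isCover = image-isCover (arr f)

  -- The pointwise image of `f` is a mono in `Psh` through which `f` factors, hence invertible; so
  -- `arr f` is a cover followed by an isomorphism.
  Psh-cover⇒cover : ∀ {X Y} {f : PshHom X Y} → PM.Cover f → Cover (arr f)
  Psh-cover⇒cover {f = f} f-cover =
    cover-resp-≈ (imageCover-∘ f)
      (cover-∘ (iso⇒cover (record { inv = arr inv ; invˡ = invˡ ; invʳ = invʳ }))
               (imageCover-isCover f))
    where
      open PM.Subobject (imageSub f) renaming (arr to m; mono to m-mono)
      open PM.IsIso (f-cover m (imageCover f) m-mono (imageCover-∘ f))

-- Multi-valued sections of presheaf maps given by generators.

module PresheafMvs {o ℓ e s} (𝓔 : PredicativeCategoryWithSmallMaps o ℓ e s)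
         (ℂ : InternalCategory (PredicativeCategoryWithSmallMaps.category 𝓔)
                               (PredicativeCategoryWithSmallMaps.pullback 𝓔)) where
  open PredicativeCategoryWithSmallMaps 𝓔
  open IsClassOfSmallMaps isClassOfSmallMaps
  open CategoryLemmas category
  open PullbackLemmas category pullback
  open SmallLemmas 𝓔
  open Presheaves category pullback ℂ
  open PresheafLemmas category pullback ℂ
  open PresheafImages 𝓔 ℂ
  open Presheaf
  open PshHom
  private
    module PG = Generalized Psh Psh-pullbacks (PointwiseSmall Small)
    module PW = WithPullbacks Psh Psh-pullbacks

    module PM = Morphisms Psh

  module _ {X A B Y : Presheaf} {φ : PshHom B A} {α : PshHom A X} {β : PshHom B X}
           (β≈ : arr β ≈ arr α ∘ arr φ) {y : PshHom Y X}
           (S : PM.Subobject (y PW.×ₚ β))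
           {G : Obj} {c : G ⇒ obj (PM.Subobject.dom S)} (c-cover : Cover c)
           {δ : G ⇒ arr y ×ₚ arr α} (δ-cover : Cover δ) (δ-small : Small δ)
           (π₁-δ : π₁ (arr y) (arr α) ∘ δ ≈
                   π₁ (arr y) (arr β) ∘ (arr (PM.Subobject.arr S) ∘ c))
           (π₂-δ : π₂ (arr y) (arr α) ∘ δ ≈
                   arr φ ∘ (π₂ (arr y) (arr β) ∘ (arr (PM.Subobject.arr S) ∘ c))) where
    private
      open Category Psh using () renaming (_∘_ to _∘ₕ_)

      m : PshHom (PM.Subobject.dom S) (y PW.×ₚ β)
      m = PM.Subobject.arr S

      i : PshHom (PM.Subobject.dom S) Y
      i = PW.π₁ y β ∘ₕ m

      v : PshHom (PM.Subobject.dom S) A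
      v = φ ∘ₕ (PW.π₂ y β ∘ₕ m)

      i-v : arr y ∘ arr i ≈ arr α ∘ arr v
      i-v = extend (square (arr y) (arr β)) ∙ ∘-congʳ β≈ ∙ assoc _ _ _

      p : PshHom (PM.Subobject.dom S) (y PW.×ₚ α)
      p = PW.pair y α i v i-v

      p-c : arr p ∘ c ≈ δ
      p-c = joint-mono
        (pullˡ π₁-pair ∙ assoc _ _ _ ∙ Eq.sym π₁-δ)
        (pullˡ π₂-pair ∙ assoc _ _ _ ∙ ∘-congˡ (assoc _ _ _) ∙ Eq.sym π₂-δ)

    -- Both conditions on the projection are tested on `G`: its composite with the cover `c` is `δ`,
    -- and covers cancel on the right, while smallness descends by the quotient axiom.
    coveredMvs : PG.Mvs′ φ α β y
    coveredMvs = record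
      { sub     = S
      ; proj    = p
      ; π₁-proj = π₁-pair
      ; π₂-proj = π₂-pair
      ; cover   = cover⇒Psh-cover {f = p} (cover-cancel c (cover-resp-≈ (Eq.sym p-c) δ-cover))
      ; small   = quotients c-cover (small-resp-≈ (Eq.sym p-c) δ-small)
      }

  -- The cover by `G` is kept as data, so that later arguments can use elements of `G` in place of
  -- elements of an image.
  record GeneratedMvs {X A B Y G : Presheaf} (φ : PshHom B A) (α : PshHom A X) (β : PshHom B X)
                      (y : PshHom Y X) (j : PshHom G Y) (b : PshHom G B) :
                      Set (o ⊔ ℓ ⊔ e ⊔ s) where
    field
      mvs : PG.Mvs′ φ α β y
    open PG.Mvs′ mvs using (sub; index; value)
    field
      generators       : obj G ⇒ obj (PM.Subobject.dom sub)
      generators-cover : Cover generators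
      index-generators : arr index ∘ generators ≈ arr j
      value-generators : arr value ∘ generators ≈ arr b

  module _ {X A B Y G : Presheaf} {φ : PshHom B A} {α : PshHom A X} {β : PshHom B X}
           (β≈ : arr β ≈ arr α ∘ arr φ) {y : PshHom Y X}
           (j : PshHom G Y) (b : PshHom G B) (y-j : arr y ∘ arr j ≈ arr β ∘ arr b)
           {δ : obj G ⇒ arr y ×ₚ arr α} (δ-cover : Cover δ) (δ-small : Small δ)
           (π₁-δ : π₁ (arr y) (arr α) ∘ δ ≈ arr j)
           (π₂-δ : π₂ (arr y) (arr α) ∘ δ ≈ arr φ ∘ arr b) where
    private
      γ : PshHom G (y PW.×ₚ β)
      γ = PW.pair y β j b y-j

      S : PM.Subobject (y PW.×ₚ β)
      S = imageSub γ

      m : PshHom (PM.Subobject.dom S) (y PW.×ₚ β)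
      m = PM.Subobject.arr S

      c : obj G ⇒ obj (PM.Subobject.dom S)
      c = arr (imageCover γ)

      c-cover : Cover c
      c-cover = imageCover-isCover γ

      index≈ : π₁ (arr y) (arr β) ∘ (arr m ∘ c) ≈ arr j
      index≈ = ∘-congˡ (imageCover-∘ γ) ∙ π₁-pair

      value≈ : π₂ (arr y) (arr β) ∘ (arr m ∘ c) ≈ arr b
      value≈ = ∘-congˡ (imageCover-∘ γ) ∙ π₂-pair

    generatedMvs : GeneratedMvs φ α β y j b
    generatedMvs = record
      { mvs              = coveredMvs {φ = φ} {α} {β} β≈ {y} S {c = c} c-cover δ-cover δ-small
                             (π₁-δ ∙ Eq.sym index≈) (π₂-δ ∙ ∘-congˡ (Eq.sym value≈))
      ; generators       = c
      ; generators-cover = c-cover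
      ; index-generators = assoc _ _ _ ∙ index≈
      ; value-generators = assoc _ _ _ ∙ value≈
      }

  module _ {X A B Y Z U : Presheaf} {φ : PshHom B A} {α : PshHom A X} {β : PshHom B X}
           {y : PshHom Y X} {z : PshHom Z X} (P : PG.Mvs′ φ α β y) (Q : PG.Mvs′ φ α β z)
           (k : PshHom U Y) (l : PshHom U Z) (y-k : arr y ∘ arr k ≈ arr z ∘ arr l) where
    private
      open Category Psh using () renaming (_∘_ to _∘ₕ_; _≈_ to _≈ₕ_)
      module P = PG.Mvs′ P
      module Q = PG.Mvs′ Q

      Qa = PM.Subobject.arr Q.sub

      Qa-mono : Mono (arr Qa)
      Qa-mono = Psh-mono⇒mono {m = Qa} (PM.Subobject.mono Q.sub)

    module _ {G : Obj} {c : G ⇒ obj (PM.Subobject.dom P.sub)} (c-cover : Cover c)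
             (below : ∀ {T} (u : T ⇒ obj U) (g : T ⇒ G) → arr P.index ∘ (c ∘ g) ≈ arr k ∘ u →
                      Σ[ r ∈ T ⇒ obj (PM.Subobject.dom Q.sub) ]
                        (arr Q.index ∘ r ≈ arr l ∘ u × arr Q.value ∘ r ≈ arr P.value ∘ (c ∘ g))) where

      -- An element `p` comes from `G` only after passing to the cover `π₁ (arr p) c`. The
      -- counterpart found there descends, because it is determined by its index and value, `Qa`
      -- being mono.
      below-locally : ∀ {T} (u : PshHom T U) (p : PshHom T (PM.Subobject.dom P.sub)) →
        P.index ∘ₕ p ≈ₕ k ∘ₕ u →
        Σ[ r ∈ PshHom T (PM.Subobject.dom Q.sub) ]
          (Q.index ∘ₕ r ≈ₕ l ∘ₕ u × Q.value ∘ₕ r ≈ₕ P.value ∘ₕ p)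
      below-locally {T} u p e = corestrict Qa Qa-mono t (proj₁ w) (proj₂ w)
        , (assoc _ _ _ ∙ ∘-congˡ (proj₂ w) ∙ π₁-pair)
        , (assoc _ _ _ ∙ ∘-congˡ (proj₂ w) ∙ π₂-pair)
        where
          lu : PshHom T Z
          lu = l ∘ₕ u

          vp : PshHom T B
          vp = P.value ∘ₕ p

          lu-vp : arr z ∘ arr lu ≈ arr β ∘ arr vp
          lu-vp = Eq.sym (extend y-k) ∙ ∘-congˡ (Eq.sym e ∙ assoc _ _ _)
            ∙ extend (square (arr y) (arr β)) ∙ ∘-congˡ (Eq.sym (assoc _ _ _))

          t : PshHom T (z PW.×ₚ β)
          t = PW.pair z β lu vp lu-vp

          R₁ = π₁ (arr p) c
          R₂ = π₂ (arr p) c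

          r = below (arr u ∘ R₁) R₂
            (∘-congˡ (Eq.sym (square (arr p) c)) ∙ extend e)

          w : Σ[ w ∈ obj T ⇒ obj (PM.Subobject.dom Q.sub) ] arr Qa ∘ w ≈ arr t
          w = cover-lift (cover-stable (arr p) c c-cover) Qa-mono (joint-mono
            (Eq.sym (assoc _ _ _) ∙ proj₁ (proj₂ r) ∙ Eq.sym (assoc _ _ _) ∙ Eq.sym (pullˡ π₁-pair))
            (Eq.sym (assoc _ _ _) ∙ proj₂ (proj₂ r) ∙ ∘-congˡ (Eq.sym (square (arr p) c))
              ∙ Eq.sym (assoc _ _ _) ∙ Eq.sym (pullˡ π₂-pair)))

      refinesLocally : ∀ {X′} (y′ : PshHom Y X′) (z′ : PshHom Z X′) → Cover (arr l) →
                       arr y′ ∘ arr k ≈ arr z′ ∘ arr l → PG.Refines′ y′ P z′ Q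
      refinesLocally y′ z′ l-cover comm = record
        { k       = k
        ; l       = l
        ; l-cover = cover⇒Psh-cover {f = l} l-cover
        ; commute = comm
        ; below   = below-locally
        }

-- Reduction of a presheaf map to a map of total families in the base category.

module GenericPresheafMvs {o ℓ e s} (𝓔 : PredicativeCategoryWithSmallMaps o ℓ e s)
         (ℂ : InternalCategory (PredicativeCategoryWithSmallMaps.category 𝓔)
                               (PredicativeCategoryWithSmallMaps.pullback 𝓔)) where
  open PredicativeCategoryWithSmallMaps 𝓔 hiding (U; el)
  open Presheaves category pullback ℂ
  open IsClassOfSmallMaps isClassOfSmallMaps
  open CategoryLemmas category
  open PullbackLemmas category pullback
  open SmallLemmas 𝓔
  open InternalCategory ℂ
  open PresheafLemmas category pullback ℂ
  open PresheafImages 𝓔 ℂ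
  open PresheafMvs 𝓔 ℂ
  open HomReasoning
  open PshHom
  open Presheaf using (obj; π)
  private
    module E = Generalized category pullback Small
    module F = FullnessAxiom category pullback Small
    module PG = Generalized Psh Psh-pullbacks (PointwiseSmall Small)
    module PM = Morphisms Psh
    module S = Subobject
    open Category Psh using () renaming (_∘_ to _∘ₕ_)

  module _ (cod-small : Small cod) {X A B : Presheaf}
           (φ : PshHom B A) (α : PshHom A X) (β : PshHom B X) (β≈ : arr β ≈ arr α ∘ arr φ)
           (φ-small : Small (arr φ)) (α-small : Small (arr α)) where
    private
      module X = Presheaf X
      module A = Presheaf A
      module B = Presheaf B

    a : A.obj ⇒ X.obj
    a = arr α

    f : B.obj ⇒ A.obj
    f = arr φ

    Ā B̄ : Obj
    Ā = X.act ×ₚ a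
    B̄ = X.act ×ₚ (a ∘ f)

    -- The fibre of ᾱ over x ∈ X(c) is the set of all elements over x · g, for g : d → c.
    φ̄ : B̄ ⇒ Ā
    φ̄ = fibreMap X.act f a

    ᾱ : Ā ⇒ X.obj
    ᾱ = X.elt ∘ π₁ X.act a

    ᾱ-φ̄ : ᾱ ∘ φ̄ ≈ X.elt ∘ π₁ X.act (a ∘ f)
    ᾱ-φ̄ = assoc _ _ _ ∙ ∘-congˡ π₁-pair

    elt-small : Small X.elt
    elt-small = small-π₁ X.π cod-small

    ᾱ-small : Small ᾱ
    ᾱ-small = composition elt-small (small-π₁ X.act α-small)

    ᾱφ̄-small : Small (ᾱ ∘ φ̄)
    ᾱφ̄-small = small-resp-≈ (Eq.sym ᾱ-φ̄)
      (composition elt-small (small-π₁ X.act (composition α-small φ-small)))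

    φ̄-small : Small φ̄
    φ̄-small = small-cancel ᾱ ᾱφ̄-small

    MvsOver : {Y : Presheaf} → PshHom Y X → Set (o ⊔ ℓ ⊔ e ⊔ s)
    MvsOver y = PG.Mvs′ φ α β y

    composite : {X′ : Presheaf} {Y₀ : Obj} {v₀ : Y₀ ⇒ C₀} →
                PshHom X′ X → PshHom (free Y₀ v₀) X′ → PshHom (free Y₀ v₀) X
    composite q y = q ∘ₕ y

    RefinesOver : {X′ : Presheaf} {Y₀ : Obj} {v₀ : Y₀ ⇒ C₀} (y : PshHom (free Y₀ v₀) X′)
                  {qy : PshHom (free Y₀ v₀) X} → MvsOver qy →
                  {Z : Presheaf} (ζ : PshHom Z X′) {qζ : PshHom Z X} → MvsOver qζ → Set (o ⊔ ℓ ⊔ e ⊔ s)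
    RefinesOver y P ζ Q = PG.Refines′ y P ζ Q

    -- An element of `carrier` amounts to a point `ι` of `V`, an arrow `ḡ` along which `x ∘ ι` can
    -- be restricted, and an element `val` of `B` over that restriction.
    module Elements {V : Obj} {x : V ⇒ X.obj} (M : F.Mvs φ̄ ᾱ x) where
      open F.Mvs M public

      carrier : Obj
      carrier = S.dom sub

      ι : carrier ⇒ V
      ι = π₁ x (ᾱ ∘ φ̄) ∘ S.arr sub

      b̄ : carrier ⇒ B̄
      b̄ = π₂ x (ᾱ ∘ φ̄) ∘ S.arr sub

      m̄ : carrier ⇒ X.π ×ₚ cod
      m̄ = π₁ X.act (a ∘ f) ∘ b̄

      ḡ : carrier ⇒ C₁
      ḡ = X.mor ∘ m̄

      val : carrier ⇒ B.obj
      val = π₂ X.act (a ∘ f) ∘ b̄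

      κ : carrier ⇒ x ×ₚ ᾱ
      κ = fibreMap x φ̄ ᾱ ∘ S.arr sub

      π₁-κ : π₁ x ᾱ ∘ κ ≈ ι
      π₁-κ = pullˡ π₁-pair

      π₂-κ : π₂ x ᾱ ∘ κ ≈ φ̄ ∘ b̄
      π₂-κ = pullˡ π₂-pair ∙ assoc _ _ _

      x-ι : x ∘ ι ≈ X.elt ∘ m̄
      x-ι = extend (square x (ᾱ ∘ φ̄)) ∙ ∘-congʳ ᾱ-φ̄ ∙ assoc _ _ _

      act-m̄ : X.act ∘ m̄ ≈ (a ∘ f) ∘ val
      act-m̄ = extend (square X.act (a ∘ f))

      π-val : B.π ∘ val ≈ dom ∘ ḡ
      π-val = ∘-congʳ (Eq.sym (over (α ∘ₕ φ))) ∙ assoc _ _ _ ∙ ∘-congˡ (Eq.sym act-m̄)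
        ∙ extend X.act-dom

      ι-small : Small ι
      ι-small = small-resp-≈ π₁-κ (composition (small-π₁ x ᾱ-small) small)

    -- Presheaf sections generated by sections of `φ̄`.

    -- P is generated by the elements of M over Y₀ : every element is locally b · g, with b
    -- an element of M and g an arrow.
    record Presentation {Y₀ Y₁ : Obj} {v₀ : Y₀ ⇒ C₀} {x₁ : Y₁ ⇒ X.obj} (M : F.Mvs φ̄ ᾱ x₁)
                        (i₀ : Y₀ ⇒ Y₁) (qy : PshHom (free Y₀ v₀) X) : Set (o ⊔ ℓ ⊔ e ⊔ s) where
      open Elements M using (carrier; ι; ḡ; val)
      field
        mvs        : MvsOver qy
      open PG.Mvs′ mvs using (sub; index; value)
      field
        {gens}     : Obj
        c          : gens ⇒ obj (PM.Subobject.dom sub)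
        c-cover    : Cover c
        el         : gens ⇒ carrier
        ar         : gens ⇒ C₁
        ḡ-ar       : dom ∘ (ḡ ∘ el) ≈ cod ∘ ar
        val-ar     : B.π ∘ (val ∘ el) ≈ cod ∘ ar
        gen-c      : i₀ ∘ (gen Y₀ v₀ ∘ (arr index ∘ c)) ≈ ι ∘ el
        arrow-c    : arrow Y₀ v₀ ∘ (arr index ∘ c) ≈ (ḡ ∘ el) ⊙ ar [ ḡ-ar ]
        value-c    : arr value ∘ c ≈ (val ∘ el) B.· ar [ val-ar ]

    module _ {Y₀ Y₁ : Obj} {v₀ : Y₀ ⇒ C₀} {x₁ : Y₁ ⇒ X.obj} (M : F.Mvs φ̄ ᾱ x₁)
             (i₀ : Y₀ ⇒ Y₁) (qy : PshHom (free Y₀ v₀) X) (qy-η : arr qy ∘ η Y₀ v₀ ≈ x₁ ∘ i₀) where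
      private
        open Elements M

        Y : Presheaf
        Y = free Y₀ v₀

        gY : obj Y ⇒ Y₀
        gY = gen Y₀ v₀

        aY : obj Y ⇒ C₁
        aY = arrow Y₀ v₀

        π-xi : X.π ∘ (x₁ ∘ i₀) ≈ v₀
        π-xi = ∘-congˡ (Eq.sym qy-η) ∙ over-∘ qy (π-η Y₀ v₀)

        π-xi-∘ : ∀ {T} (t : T ⇒ obj Y) → X.π ∘ (x₁ ∘ (i₀ ∘ (gY ∘ t))) ≈ cod ∘ (aY ∘ t)
        π-xi-∘ t = ∘-congˡ (Eq.sym (assoc _ _ _)) ∙ pullˡ π-xi ∙ extend (square v₀ cod)

        -- By freeness `qy` is the transpose of `x₁ ∘ i₀`, so it sends `y · g` to the restriction
        -- along `g` of the point of `X` attached to `y`.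
        qy-∘ : ∀ {T} (t : T ⇒ obj Y) →
               arr qy ∘ t ≈ (x₁ ∘ (i₀ ∘ (gY ∘ t))) X.· aY ∘ t [ π-xi-∘ t ]
        qy-∘ t = ∘-congʳ (free-ext Y₀ v₀ {u = qy} {v = qy′} (qy-η ∙ Eq.sym (♯-η Y₀ v₀ X (x₁ ∘ i₀) π-xi)))
          ∙ ♯-∘ Y₀ v₀ X (x₁ ∘ i₀) π-xi t {∘-congˡ (assoc _ _ _) ∙ π-xi-∘ t} ∙ X.·-cong (assoc _ _ _) Eq.refl
          where
            qy′ : PshHom Y X
            qy′ = _♯ Y₀ v₀ X (x₁ ∘ i₀) π-xi

        -- Pairs of a generator `y` and an element of `M` over `i₀ y`. Such a pair is placed over
        -- the element `y · ḡ` of `Y`, by `j₁`, and has the value `val` in `B`.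
        P₀ : Obj
        P₀ = i₀ ×ₚ ι

        j₀ : P₀ ⇒ Y₀
        j₀ = π₁ i₀ ι

        p₀ : P₀ ⇒ carrier
        p₀ = π₂ i₀ ι

        x-j₀ : x₁ ∘ (i₀ ∘ j₀) ≈ X.elt ∘ (m̄ ∘ p₀)
        x-j₀ = ∘-congˡ (square i₀ ι) ∙ pullˡ x-ι ∙ assoc _ _ _

        j₁-eq : v₀ ∘ j₀ ≈ cod ∘ (ḡ ∘ p₀)
        j₁-eq = ∘-congʳ (Eq.sym π-xi) ∙ assoc _ _ _ ∙ ∘-congˡ (assoc _ _ _ ∙ x-j₀)
          ∙ extend X.elt-mor ∙ ∘-congˡ (Eq.sym (assoc _ _ _))

        j₁ : P₀ ⇒ obj Y
        j₁ = pair v₀ cod j₀ (ḡ ∘ p₀) j₁-eq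

        vG : P₀ ⇒ C₀
        vG = B.π ∘ (val ∘ p₀)

        j₁-over : π Y ∘ j₁ ≈ vG
        j₁-over = assoc _ _ _ ∙ ∘-congˡ π₂-pair ∙ Eq.sym (extend π-val)

        G : Presheaf
        G = free P₀ vG

        j : PshHom G Y
        j = _♯ P₀ vG Y j₁ j₁-over

        bG : PshHom G B
        bG = _♯ P₀ vG B (val ∘ p₀) Eq.refl

        x-j₁ : x₁ ∘ (i₀ ∘ (gY ∘ j₁)) ≈ X.elt ∘ (m̄ ∘ p₀)
        x-j₁ = ∘-congˡ (∘-congˡ π₁-pair) ∙ x-j₀

        -- Two maps out of a free presheaf are compared on generators, where the equation says that
        -- `val` lies over the restriction along `ḡ`.
        j-bG : arr qy ∘ arr j ≈ arr β ∘ arr bG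
        j-bG = free-ext P₀ vG {u = qy ∘ₕ j} {v = β ∘ₕ bG} (begin
          (arr qy ∘ arr j) ∘ η P₀ vG     ≈⟨ assoc _ _ _ ∙ ∘-congˡ (♯-η P₀ vG Y j₁ j₁-over) ⟩
          arr qy ∘ j₁                    ≈⟨ qy-∘ j₁ ⟩
          _                              ≈⟨ X.·-cong {q = extend X.elt-mor} x-j₁ (π₂-pair ∙ assoc _ _ _) ⟩
          _                              ≈⟨ Eq.sym (act-· X (m̄ ∘ p₀)) ⟩
          X.act ∘ (m̄ ∘ p₀)               ≈⟨ extend act-m̄ ⟩
          (a ∘ f) ∘ (val ∘ p₀)           ≈⟨ ∘-congʳ (Eq.sym β≈) ⟩
          arr β ∘ (val ∘ p₀)             ≈⟨ ∘-congˡ (Eq.sym (♯-η P₀ vG B (val ∘ p₀) Eq.refl)) ∙ Eq.sym (assoc _ _ _) ⟩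
          (arr β ∘ arr bG) ∘ η P₀ vG     ∎)

        D_A : Obj
        D_A = arr qy ×ₚ a

        d₁ : D_A ⇒ obj Y
        d₁ = π₁ (arr qy) a

        d₂ : D_A ⇒ A.obj
        d₂ = π₂ (arr qy) a

        δ : obj G ⇒ D_A
        δ = pair (arr qy) a (arr j) (f ∘ arr bG) (j-bG ∙ ∘-congʳ β≈ ∙ assoc _ _ _)

        π₁-δ : d₁ ∘ δ ≈ arr j
        π₁-δ = π₁-pair

        π₂-δ : d₂ ∘ δ ≈ f ∘ arr bG
        π₂-δ = π₂-pair

        gen-j : gY ∘ arr j ≈ j₀ ∘ gen P₀ vG
        gen-j = gen-· Y₀ v₀ ∙ pullˡ π₁-pair

        -- Followed by the projection to `Y₀`, `δ` becomes a pullback of `cod` followed by a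
        -- pullback of `ι`; both are small, and smallness cancels.
        δ-small : Small δ
        δ-small = small-cancel (gY ∘ d₁) (small-resp-≈ (Eq.sym (assoc _ _ _ ∙ ∘-congˡ π₁-δ ∙ gen-j))
          (composition (small-π₁ i₀ ι-small) (small-π₁ vG cod-small)))

        -- An element ((y , g) , a) of D_A determines an element of Ā over i₀ y, which has a
        -- preimage in M; that preimage is a generator mapped to ((y , g) , a).
        i : D_A ⇒ Y₁
        i = i₀ ∘ (gY ∘ d₁)

        xk : D_A ⇒ X.π ×ₚ cod
        xk = pair X.π cod (x₁ ∘ i) (aY ∘ d₁) (π-xi-∘ d₁)

        xk-a : X.act ∘ xk ≈ a ∘ d₂
        xk-a = Eq.sym (qy-∘ d₁) ∙ square (arr qy) a

        ā : D_A ⇒ Ā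
        ā = pair X.act a xk d₂ xk-a

        t : D_A ⇒ x₁ ×ₚ ᾱ
        t = pair x₁ ᾱ i ā (Eq.sym (assoc _ _ _ ∙ ∘-congˡ π₁-pair ∙ π₁-pair))

        t₁ : t ×ₚ κ ⇒ D_A
        t₁ = π₁ t κ

        t₂ : t ×ₚ κ ⇒ carrier
        t₂ = π₂ t κ

        ι-t₂ : ι ∘ t₂ ≈ i ∘ t₁
        ι-t₂ = Eq.sym (pullˡ π₁-κ) ∙ ∘-congˡ (Eq.sym (square t κ)) ∙ pullˡ π₁-pair

        φ̄b̄-t₂ : (φ̄ ∘ b̄) ∘ t₂ ≈ ā ∘ t₁
        φ̄b̄-t₂ = Eq.sym (pullˡ π₂-κ) ∙ ∘-congˡ (Eq.sym (square t κ)) ∙ pullˡ π₂-pair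

        m̄-t₂ : m̄ ∘ t₂ ≈ xk ∘ t₁
        m̄-t₂ = ∘-congʳ (Eq.sym (pullˡ π₁-pair)) ∙ assoc _ _ _ ∙ ∘-congˡ φ̄b̄-t₂ ∙ pullˡ π₁-pair

        f-val-t₂ : f ∘ (val ∘ t₂) ≈ d₂ ∘ t₁
        f-val-t₂ = ∘-congˡ (assoc _ _ _) ∙ Eq.sym (assoc _ _ _) ∙ Eq.sym (pullˡ π₂-pair)
          ∙ ∘-congˡ (Eq.sym (assoc _ _ _)) ∙ ∘-congˡ φ̄b̄-t₂ ∙ pullˡ π₂-pair

        σ : t ×ₚ κ ⇒ P₀
        σ = pair i₀ ι (gY ∘ (d₁ ∘ t₁)) t₂
          (∘-congˡ (Eq.sym (assoc _ _ _)) ∙ Eq.sym (assoc _ _ _) ∙ Eq.sym ι-t₂)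

        j₁-σ : j₁ ∘ σ ≈ d₁ ∘ t₁
        j₁-σ = joint-mono
          (pullˡ π₁-pair ∙ π₁-pair)
          (pullˡ π₂-pair ∙ assoc _ _ _ ∙ ∘-congˡ π₂-pair ∙ assoc _ _ _ ∙ ∘-congˡ m̄-t₂
            ∙ pullˡ π₂-pair ∙ assoc _ _ _)

        δ-η-σ : (δ ∘ η P₀ vG) ∘ σ ≈ t₁
        δ-η-σ = assoc _ _ _ ∙ joint-mono
          (pullˡ π₁-δ ∙ pullˡ (♯-η P₀ vG Y j₁ j₁-over) ∙ j₁-σ)
          (pullˡ π₂-δ ∙ assoc _ _ _ ∙ ∘-congˡ (pullˡ (♯-η P₀ vG B (val ∘ p₀) Eq.refl)
            ∙ assoc _ _ _ ∙ ∘-congˡ π₂-pair) ∙ f-val-t₂)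

        δ-cover : Cover δ
        δ-cover = cover-cancel (η P₀ vG) (cover-locally t cover σ δ-η-σ)

        generated : GeneratedMvs φ α β qy j bG
        generated = generatedMvs {X} {A} {B} {Y} {G} {φ} {α} {β} β≈ {qy} j bG j-bG {δ}
          δ-cover δ-small π₁-δ π₂-δ

        module GM = GeneratedMvs generated

        p₁ : obj G ⇒ carrier
        p₁ = p₀ ∘ gen P₀ vG

        val-ar : B.π ∘ (val ∘ p₁) ≈ cod ∘ arrow P₀ vG
        val-ar = ∘-congˡ (Eq.sym (assoc _ _ _)) ∙ Eq.sym (assoc _ _ _) ∙ square vG cod

        ḡ-ar : dom ∘ (ḡ ∘ p₁) ≈ cod ∘ arrow P₀ vG
        ḡ-ar = Eq.sym (extend π-val) ∙ val-ar

        arrow-j₁ : aY ∘ (j₁ ∘ gen P₀ vG) ≈ ḡ ∘ p₁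
        arrow-j₁ = pullˡ π₂-pair ∙ assoc _ _ _

      abstract
        presentation : Presentation M i₀ qy
        presentation = record
          { mvs     = GM.mvs
          ; c       = GM.generators
          ; c-cover = GM.generators-cover
          ; el      = p₁
          ; ar      = arrow P₀ vG
          ; ḡ-ar    = ḡ-ar
          ; val-ar  = val-ar
          ; gen-c   = ∘-congˡ (∘-congˡ GM.index-generators ∙ gen-j) ∙ extend (square i₀ ι)
          ; arrow-c = ∘-congˡ GM.index-generators
              ∙ arrow-· Y₀ v₀ {q = ∘-congˡ arrow-j₁ ∙ ḡ-ar} ∙ ⊙-cong arrow-j₁ Eq.refl
          ; value-c = GM.value-generators ∙ B.·-cong (assoc _ _ _) Eq.refl
          }

    -- Turning a presheaf section into a section of `φ̄`.

    -- Elements b of M over v ∈ V, where M lies over x · g, are carried to elements of Q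
    -- over ζ₁ v · g.
    record Translation {Z : Presheaf} {qζ : PshHom Z X} (Q : MvsOver qζ)
                       {V : Obj} (x : V ⇒ X.obj) (ζ₁ : V ⇒ obj Z) : Set (o ⊔ ℓ ⊔ e ⊔ s) where
      private
        module Z = Presheaf Z
      open PG.Mvs′ Q using (sub; index; value)
      field
        mvs          : F.Mvs φ̄ ᾱ x
      open Elements mvs using (carrier; ι; ḡ; val)
      field
        lift         : carrier ⇒ obj (PM.Subobject.dom sub)
        translatable : Z.π ∘ (ζ₁ ∘ ι) ≈ cod ∘ ḡ
        index-lift   : arr index ∘ lift ≈ (ζ₁ ∘ ι) Z.· ḡ [ translatable ]
        value-lift   : arr value ∘ lift ≈ val

    module _ {Z : Presheaf} {qζ : PshHom Z X} (Q : MvsOver qζ)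
             {V : Obj} {x : V ⇒ X.obj} {ζ₁ : V ⇒ obj Z} (qζ-ζ₁ : arr qζ ∘ ζ₁ ≈ x) where
      private
        module Z = Presheaf Z
        module Q = PG.Mvs′ Q

        Qd : Presheaf
        Qd = PM.Subobject.dom Q.sub

        Qa : obj Qd ⇒ arr qζ ×ₚ arr β
        Qa = arr (PM.Subobject.arr Q.sub)

        -- One construction for both families: `θ` is `a ∘ f` for `B̄` and `a` for `Ā`. A point `v`
        -- with an arrow `g` and an element of `E` goes to `ζ₁ v · g`, which lies over the same
        -- point of `X` as that element.
        module Shift {E : Obj} (θ : E ⇒ X.obj) {σ : X.act ×ₚ θ ⇒ X.obj}
                     (σ≈ : σ ≈ X.elt ∘ π₁ X.act θ) where

          xg : x ×ₚ σ ⇒ X.π ×ₚ cod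
          xg = π₁ X.act θ ∘ π₂ x σ

          elem : x ×ₚ σ ⇒ E
          elem = π₂ X.act θ ∘ π₂ x σ

          base : x ×ₚ σ ⇒ Z.obj
          base = ζ₁ ∘ π₁ x σ

          q-base : arr qζ ∘ base ≈ X.elt ∘ xg
          q-base = pullˡ qζ-ζ₁ ∙ square x σ ∙ ∘-congʳ σ≈ ∙ assoc _ _ _

          base-mor : Z.π ∘ base ≈ cod ∘ (X.mor ∘ xg)
          base-mor = ∘-congʳ (Eq.sym (over qζ)) ∙ assoc _ _ _ ∙ ∘-congˡ q-base ∙ extend X.elt-mor

          shifted : x ×ₚ σ ⇒ Z.obj
          shifted = base Z.· X.mor ∘ xg [ base-mor ]

          q-shifted : arr qζ ∘ shifted ≈ θ ∘ elem
          q-shifted = hom-· qζ {q = ∘-congˡ q-base ∙ extend X.elt-mor} ∙ X.·-cong q-base Eq.refl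
            ∙ Eq.sym (act-· X xg) ∙ extend (square X.act θ)

        module SB = Shift (a ∘ f) ᾱ-φ̄
        module SA = Shift a {ᾱ} Eq.refl

        ψ : x ×ₚ (ᾱ ∘ φ̄) ⇒ arr qζ ×ₚ arr β
        ψ = pair (arr qζ) (arr β) SB.shifted SB.elem (SB.q-shifted ∙ ∘-congʳ (Eq.sym β≈))

        ψA : x ×ₚ ᾱ ⇒ arr qζ ×ₚ a
        ψA = pair (arr qζ) a SA.shifted SA.elem SA.q-shifted

        κQ : obj Qd ⇒ arr qζ ×ₚ a
        κQ = arr Q.proj

        Qa-sub : Subobject (arr qζ ×ₚ arr β)
        Qa-sub = record
          { arr  = Qa
          ; mono = Psh-mono⇒mono {m = PM.Subobject.arr Q.sub} (PM.Subobject.mono Q.sub)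
          }

        -- The small map `Q.proj` is `Qa` followed by the map that `φ` induces on fibre products, so
        -- smallness cancels.
        Qa-small : Small Qa
        Qa-small = small-cancel
          (pair (arr qζ) a (π₁ (arr qζ) (arr β)) (f ∘ π₂ (arr qζ) (arr β))
            (square (arr qζ) (arr β) ∙ ∘-congʳ β≈ ∙ assoc _ _ _))
          (small-resp-≈ (joint-mono (Q.π₁-proj ∙ Eq.sym (pullˡ π₁-pair))
                                    (Q.π₂-proj ∙ Eq.sym (pullˡ π₂-pair ∙ assoc _ _ _)))
                        Q.small)

        fm : x ×ₚ (ᾱ ∘ φ̄) ⇒ x ×ₚ ᾱ
        fm = fibreMap x φ̄ ᾱ

        fm-small : Small fm
        fm-small = small-cancel (π₁ x ᾱ)
          (small-resp-≈ (Eq.sym π₁-pair) (small-π₁ x ᾱφ̄-small))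

        D : Obj
        D = ψA ×ₚ κQ

        t₁ : D ⇒ x ×ₚ ᾱ
        t₁ = π₁ ψA κQ

        t₂ : D ⇒ obj Qd
        t₂ = π₂ ψA κQ

        iQ : D ⇒ Z.obj
        iQ = arr Q.index ∘ t₂

        vQ : D ⇒ B.obj
        vQ = arr Q.value ∘ t₂

        shifted-t : SA.shifted ∘ t₁ ≈ iQ
        shifted-t = Eq.sym (pullˡ π₁-pair) ∙ ∘-congˡ (square ψA κQ) ∙ pullˡ Q.π₁-proj

        elem-t : SA.elem ∘ t₁ ≈ f ∘ vQ
        elem-t = Eq.sym (pullˡ π₂-pair) ∙ ∘-congˡ (square ψA κQ) ∙ pullˡ Q.π₂-proj ∙ assoc _ _ _

        b-eq : X.act ∘ (SA.xg ∘ t₁) ≈ (a ∘ f) ∘ vQ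
        b-eq = extend (extend (square X.act a)) ∙ ∘-congˡ elem-t ∙ Eq.sym (assoc _ _ _)

        b : D ⇒ B̄
        b = pair X.act (a ∘ f) (SA.xg ∘ t₁) vQ b-eq

        τ : D ⇒ x ×ₚ (ᾱ ∘ φ̄)
        τ = pair x (ᾱ ∘ φ̄) (π₁ x ᾱ ∘ t₁) b
          (extend (square x ᾱ) ∙ assoc _ _ _ ∙ ∘-congˡ (Eq.sym (assoc _ _ _))
            ∙ Eq.sym (∘-congʳ ᾱ-φ̄ ∙ assoc _ _ _ ∙ ∘-congˡ π₁-pair))

        xg-τ : SB.xg ∘ τ ≈ SA.xg ∘ t₁
        xg-τ = assoc _ _ _ ∙ ∘-congˡ π₂-pair ∙ π₁-pair

        base-τ : SB.base ∘ τ ≈ SA.base ∘ t₁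
        base-τ = assoc _ _ _ ∙ ∘-congˡ π₁-pair ∙ Eq.sym (assoc _ _ _)

        shifted-τ : SB.shifted ∘ τ ≈ SA.shifted ∘ t₁
        shifted-τ = Z.·-∘ τ {extend SB.base-mor}
          ∙ Z.·-cong {q = extend SA.base-mor} base-τ
              (assoc _ _ _ ∙ ∘-congˡ xg-τ ∙ Eq.sym (assoc _ _ _))
          ∙ Eq.sym (Z.·-∘ t₁)

        elem-τ : SB.elem ∘ τ ≈ vQ
        elem-τ = assoc _ _ _ ∙ ∘-congˡ π₂-pair ∙ π₂-pair

        ψ-τ : ψ ∘ τ ≈ Qa ∘ t₂
        ψ-τ = joint-mono
          (pullˡ π₁-pair ∙ shifted-τ ∙ shifted-t ∙ assoc _ _ _)
          (pullˡ π₂-pair ∙ elem-τ ∙ assoc _ _ _)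

        fm-τ : fm ∘ τ ≈ t₁
        fm-τ = joint-mono
          (pullˡ π₁-pair ∙ π₁-pair)
          (pullˡ π₂-pair ∙ assoc _ _ _ ∙ ∘-congˡ π₂-pair ∙ joint-mono
            (pullˡ π₁-pair ∙ π₁-pair ∙ assoc _ _ _)
            (pullˡ π₂-pair ∙ assoc _ _ _ ∙ ∘-congˡ π₂-pair ∙ Eq.sym elem-t ∙ assoc _ _ _))

        -- `Q` meets each translated element of `Ā` after passing to the cover `D`; `τ` reads the
        -- value found there as an element of `B̄` over the original point.
        translated-cover : Cover (fm ∘ π₁ ψ Qa)
        translated-cover = cover-locally ψA (Psh-cover⇒cover {f = Q.proj} Q.cover)
          (pair ψ Qa τ t₂ ψ-τ) (assoc _ _ _ ∙ ∘-congˡ π₁-pair ∙ fm-τ)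

        -- The inverse image of `Q` under `ψ`: a value over `v` and `g` belongs to it when it
        -- belongs to `Q` over `ζ₁ v · g`.
        translated : F.Mvs φ̄ ᾱ x
        translated = record
          { sub   = ψ ^* Qa-sub
          ; cover = translated-cover
          ; small = composition fm-small (small-π₁ ψ Qa-small)
          }

        module T = Elements translated

        mor-ψ : (X.mor ∘ SB.xg) ∘ π₁ ψ Qa ≈ T.ḡ
        mor-ψ = assoc _ _ _ ∙ ∘-congˡ (assoc _ _ _)

        base-ψ : SB.base ∘ π₁ ψ Qa ≈ ζ₁ ∘ T.ι
        base-ψ = assoc _ _ _

        translatable : Z.π ∘ (ζ₁ ∘ T.ι) ≈ cod ∘ T.ḡ
        translatable = ∘-congˡ (Eq.sym base-ψ) ∙ extend SB.base-mor ∙ ∘-congˡ mor-ψ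

      abstract
        translation : Translation Q x ζ₁
        translation = record
          { mvs          = translated
          ; lift         = π₂ ψ Qa
          ; translatable = translatable
          ; index-lift   = assoc _ _ _ ∙ ∘-congˡ (Eq.sym (square ψ Qa)) ∙ pullˡ π₁-pair
              ∙ Z.·-∘ (π₁ ψ Qa) {extend SB.base-mor} ∙ Z.·-cong base-ψ mor-ψ
          ; value-lift   = assoc _ _ _ ∙ ∘-congˡ (Eq.sym (square ψ Qa)) ∙ pullˡ π₂-pair ∙ assoc _ _ _
          }

    -- Extending refinements from generators to presheaves.

    -- A refinement U₀ of the generators in 𝓔 extends freely to a refinement in Psh.
    module _ {X′ : Presheaf} (q : PshHom X′ X) {X₁ : Obj} (q₁ : X₁ ⇒ X.obj)
             {Y₀ Y₁ : Obj} {v₀ : Y₀ ⇒ C₀} {y₁ : Y₁ ⇒ X₁} {P₁ : F.Mvs φ̄ ᾱ (q₁ ∘ y₁)} {i₀ : Y₀ ⇒ Y₁}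
             (y : PshHom (free Y₀ v₀) X′) {qy : PshHom (free Y₀ v₀) X}
             (qy≈ : arr qy ≈ arr q ∘ arr y) (P̂ : Presentation P₁ i₀ qy)
             {Z : Presheaf} (ζ : PshHom Z X′) {qζ : PshHom Z X} (qζ≈ : arr qζ ≈ arr q ∘ arr ζ)
             {Q : MvsOver qζ} {Z₁ : Obj} {z₁ : Z₁ ⇒ X₁} {ζ₁ : Z₁ ⇒ obj Z} (ζ₁-cover : Cover ζ₁)
             (Q̂ : Translation Q (q₁ ∘ z₁) ζ₁)
             (R : F.Refines φ̄ ᾱ q₁ y₁ P₁ z₁ (Translation.mvs Q̂))
             (k₁ : F.Refines.U R ⇒ Y₀) (i₀-k₁ : i₀ ∘ k₁ ≈ F.Refines.k R)
             (y-k₁ : arr y ∘ (η Y₀ v₀ ∘ k₁) ≈ arr ζ ∘ (ζ₁ ∘ F.Refines.l R)) where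
      private
        open F.Refines R using () renaming (U to U₀; k to k₀; l to l₀)
        open Presentation P̂ renaming (mvs to P)
        open Translation Q̂ renaming (mvs to Q₁)
        module Z = Presheaf Z
        module P = PG.Mvs′ P
        module Q = PG.Mvs′ Q
        module P₁ = Elements P₁
        module Q₁ = Elements Q₁

        Y : Presheaf
        Y = free Y₀ v₀

        vU : U₀ ⇒ C₀
        vU = Z.π ∘ (ζ₁ ∘ l₀)

        k₁-over : v₀ ∘ k₁ ≈ vU
        k₁-over = ∘-congʳ (Eq.sym (over-∘ y (π-η Y₀ v₀))) ∙ assoc _ _ _
          ∙ ∘-congˡ (assoc _ _ _ ∙ y-k₁) ∙ pullˡ (over ζ)

        U : Presheaf
        U = free U₀ vU

        k : PshHom U Y
        k = freeMap {U₀} {Y₀} {vU} {v₀} k₁ k₁-over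

        l : PshHom U Z
        l = _♯ U₀ vU Z (ζ₁ ∘ l₀) Eq.refl

        l-η : arr l ∘ η U₀ vU ≈ ζ₁ ∘ l₀
        l-η = ♯-η U₀ vU Z (ζ₁ ∘ l₀) Eq.refl

        l-cover : Cover (arr l)
        l-cover = cover-cancel (η U₀ vU) (cover-resp-≈ (Eq.sym l-η)
          (cover-∘ ζ₁-cover (F.Refines.l-cover R)))

        y-k : arr y ∘ arr k ≈ arr ζ ∘ arr l
        y-k = free-ext U₀ vU {u = y ∘ₕ k} {v = ζ ∘ₕ l}
          (assoc _ _ _ ∙ ∘-congˡ (♯-η U₀ vU Y (η Y₀ v₀ ∘ k₁) _) ∙ y-k₁
            ∙ Eq.sym (assoc _ _ _ ∙ ∘-congˡ l-η))

        qy-k : arr qy ∘ arr k ≈ arr qζ ∘ arr l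
        qy-k = ∘-congʳ qy≈ ∙ assoc _ _ _ ∙ ∘-congˡ y-k ∙ pullˡ (Eq.sym qζ≈)

      private
        module _ {T : Obj} (u : T ⇒ obj U) (g : T ⇒ gens)
                 (c-g : arr P.index ∘ (c ∘ g) ≈ arr k ∘ u) where
          u₀ : T ⇒ U₀
          u₀ = gen U₀ vU ∘ u

          p : T ⇒ P₁.carrier
          p = el ∘ g

          γ : T ⇒ C₁
          γ = ar ∘ g

          ι-p : P₁.ι ∘ p ≈ k₀ ∘ u₀
          ι-p = Eq.sym (extend gen-c) ∙ ∘-congˡ (assoc _ _ _ ∙ ∘-congˡ (assoc _ _ _ ∙ c-g)
            ∙ extend (gen-freeMap {U₀} {Y₀} {vU} {v₀} k₁ k₁-over)) ∙ pullˡ i₀-k₁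

          composable : dom ∘ (P₁.ḡ ∘ p) ≈ cod ∘ γ
          composable = ∘-congˡ (Eq.sym (assoc _ _ _)) ∙ extend ḡ-ar

          val-γ : B.π ∘ (P₁.val ∘ p) ≈ cod ∘ γ
          val-γ = ∘-congˡ (Eq.sym (assoc _ _ _)) ∙ extend val-ar

          arrow≈ : (P₁.ḡ ∘ p) ⊙ γ [ composable ] ≈ arrow U₀ vU ∘ u
          arrow≈ = ⊙-cong {p′ = extend ḡ-ar} (Eq.sym (assoc _ _ _)) Eq.refl
            ∙ Eq.sym (⊙-∘ g {extend ḡ-ar}) ∙ ∘-congʳ (Eq.sym arrow-c)
            ∙ assoc _ _ _ ∙ ∘-congˡ (assoc _ _ _ ∙ c-g) ∙ pullˡ (arrow-freeMap {U₀} {Y₀} {vU} {v₀} k₁ k₁-over)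

          below₁ : Σ[ r ∈ T ⇒ Q₁.carrier ] (_ × _)
          below₁ = E.below-elements R u₀ p (Eq.sym (assoc _ _ _) ∙ ι-p)

          r₁ : T ⇒ Q₁.carrier
          r₁ = proj₁ below₁

          ι-r₁ : Q₁.ι ∘ r₁ ≈ l₀ ∘ u₀
          ι-r₁ = assoc _ _ _ ∙ proj₁ (proj₂ below₁)

          b̄-r₁ : Q₁.b̄ ∘ r₁ ≈ P₁.b̄ ∘ p
          b̄-r₁ = assoc _ _ _ ∙ proj₂ (proj₂ below₁) ∙ Eq.sym (assoc _ _ _)

          ḡ-r₁ : Q₁.ḡ ∘ r₁ ≈ P₁.ḡ ∘ p
          ḡ-r₁ = assoc _ _ _ ∙ ∘-congˡ (assoc _ _ _ ∙ ∘-congˡ b̄-r₁ ∙ Eq.sym (assoc _ _ _))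
            ∙ Eq.sym (assoc _ _ _)

          ζ₁-square : Z.π ∘ (ζ₁ ∘ (l₀ ∘ u₀)) ≈ cod ∘ (P₁.ḡ ∘ p)
          ζ₁-square = ∘-congˡ (∘-congˡ (Eq.sym ι-r₁) ∙ Eq.sym (assoc _ _ _))
            ∙ extend translatable ∙ ∘-congˡ ḡ-r₁

          r₀ : T ⇒ obj (PM.Subobject.dom Q.sub)
          r₀ = lift ∘ r₁

          index-r₀ : arr Q.index ∘ r₀ ≈ (ζ₁ ∘ (l₀ ∘ u₀)) Z.· P₁.ḡ ∘ p [ ζ₁-square ]
          index-r₀ = pullˡ index-lift ∙ Z.·-∘ r₁ {extend translatable}
            ∙ Z.·-cong (assoc _ _ _ ∙ ∘-congˡ ι-r₁) ḡ-r₁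

          value-r₀ : arr Q.value ∘ r₀ ≈ P₁.val ∘ p
          value-r₀ = pullˡ value-lift ∙ assoc _ _ _ ∙ ∘-congˡ b̄-r₁ ∙ Eq.sym (assoc _ _ _)

          r₀-square : π (PM.Subobject.dom Q.sub) ∘ r₀ ≈ cod ∘ γ
          r₀-square = ∘-congʳ (Eq.sym (over Q.value)) ∙ assoc _ _ _ ∙ ∘-congˡ value-r₀ ∙ val-γ

          -- The element of `P` named by `g` is `val · γ` for an element `p` of `P₁`. The refinement
          -- in the base category carries `p` to `r₁`, translation carries that into `Q`, and `Q` is
          -- closed under acting by `γ`.
          r : T ⇒ obj (PM.Subobject.dom Q.sub)
          r = Presheaf._·_[_] (PM.Subobject.dom Q.sub) r₀ γ r₀-square

          index-r : arr Q.index ∘ r ≈ arr l ∘ u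
          index-r = hom-· Q.index {q = over-∘ Q.index r₀-square}
            ∙ Z.·-cong {q = Z.π-· _ _ _ ∙ composable} index-r₀ Eq.refl
            ∙ ·-· Z {r = composable} {s = ζ₁-square ∙ Eq.sym cod-⊙}
            ∙ Z.·-cong (Eq.sym (assoc _ _ _)) arrow≈
            ∙ Eq.sym (♯-∘ U₀ vU Z (ζ₁ ∘ l₀) Eq.refl u
                {Eq.sym (assoc _ _ _) ∙ extend (square vU cod)})

          value-r : arr Q.value ∘ r ≈ arr P.value ∘ (c ∘ g)
          value-r = hom-· Q.value {q = over-∘ Q.value r₀-square}
            ∙ B.·-cong {q = extend val-ar} (value-r₀ ∙ Eq.sym (assoc _ _ _)) Eq.refl
            ∙ Eq.sym (pullˡ value-c ∙ B.·-∘ g)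

      refinement : RefinesOver {X′} {Y₀} {v₀} y {qy} P {Z} ζ {qζ} Q
      refinement = refinesLocally {X} {A} {B} {Y} {Z} {U} {φ} {α} {β} {qy} {qζ} P Q k l qy-k
        {gens} {c} c-cover (λ u g c-g → r u g c-g , index-r u g c-g , value-r u g c-g)
        {X′} y ζ l-cover y-k

    assemble : ∀ {X′ : Presheaf} (q : PshHom X′ X) → Cover (arr q) →
               ∀ {Y₀ Y₁ : Obj} {v₀ : Y₀ ⇒ C₀} {x₁ : Y₁ ⇒ X.obj} {P₁ : F.Mvs φ̄ ᾱ x₁} {i₀ : Y₀ ⇒ Y₁}
               (y : PshHom (free Y₀ v₀) X′) → Small (arr y) →
               (P̂ : Presentation P₁ i₀ (composite {X′} {Y₀} {v₀} q y)) →
               (∀ {Z : Presheaf} (ζ : PshHom Z X′) {qζ : PshHom Z X} → arr qζ ≈ arr q ∘ arr ζ →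
                (Q : MvsOver qζ) →
                RefinesOver {X′} {Y₀} {v₀} y {composite {X′} {Y₀} {v₀} q y} (Presentation.mvs P̂) {Z} ζ {qζ} Q) →
               PG.GenericMvs′ φ α β
    assemble {X′} q q-cover y y-small P̂ generic = record
      { q       = q
      ; q-cover = cover⇒Psh-cover {X′} {X} {q} q-cover
      ; y       = y
      ; y-small = y-small
      ; qy      = q ∘ₕ y
      ; qy≡     = refl
      ; P       = Presentation.mvs P̂
      ; generic = λ { ζ refl Q → generic ζ Eq.refl Q }
      }

    -- The free presheaves `X′` and `Y` obtained from Collection, and genericity.

    module _ (J : F.GenericMvs φ̄ ᾱ) where
      open F.GenericMvs J
        renaming (X′ to X₁; Y to Y₁; q to q₁; q-cover to q₁-cover; y to y₁; y-small to y₁-small;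
                  P to P₁; generic to generic₁)

      -- The outcome of Collection: w ∈ W over x carries a small family N_w of arrows g
      -- and of elements of X₁ above x · g, in which every g occurs.
      module _ {N W : Obj} (z : N ⇒ X.act ×ₚ q₁) {ν : N ⇒ W} {h : W ⇒ X.obj} (ν-small : Small ν)
               (square-z : CoveringSquare (π₁ X.act q₁ ∘ z) ν h X.elt) where
        open CoveringSquare square-z renaming (bot-cover to h-cover)
        open QuasiPullback quasiPullback renaming (commute to h-ν)

        private
          μ : N ⇒ X.π ×ₚ cod
          μ = π₁ X.act q₁ ∘ z

          ξ : N ⇒ X₁
          ξ = π₂ X.act q₁ ∘ z

          act-μ : X.act ∘ μ ≈ q₁ ∘ ξ
          act-μ = extend (square X.act q₁)

          X′ : Presheaf
          X′ = free W (X.π ∘ h)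

          q : PshHom X′ X
          q = _♯ W (X.π ∘ h) X h Eq.refl

          q-cover : Cover (arr q)
          q-cover = cover-cancel (η W (X.π ∘ h))
            (cover-resp-≈ (Eq.sym (♯-η W (X.π ∘ h) X h Eq.refl)) h-cover)

          -- Opaque, since conversion checking must not unfold it inside presheaves.
          abstract
            Y₀ : Obj
            Y₀ = ξ ×ₚ y₁

            n₀ : Y₀ ⇒ N
            n₀ = π₁ ξ y₁

            i₀ : Y₀ ⇒ Y₁
            i₀ = π₂ ξ y₁

            Y₀-pullback : IsPullback n₀ i₀ ξ y₁
            Y₀-pullback = Pullback.isPullback (pullback ξ y₁)

          open IsPullback Y₀-pullback using () renaming (commute to ξ-y₁; universal to ⟪_,_⟫[_]; proj₁-∘ to n₀-∘; proj₂-∘ to i₀-∘)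

          v₀ : Y₀ ⇒ C₀
          v₀ = dom ∘ (X.mor ∘ (μ ∘ n₀))

          -- An `n` in the family of `w`, together with an index over the lift `ξ n`, is sent to
          -- `w · g`, where `g` is the arrow of `n`; accordingly `v₀` is the domain of `g`.
          y₀ : Y₀ ⇒ obj X′
          y₀ = pair (X.π ∘ h) cod (ν ∘ n₀) (X.mor ∘ (μ ∘ n₀))
            (assoc _ _ _ ∙ ∘-congˡ (extend h-ν) ∙ extend X.elt-mor)

          y₀-over : π X′ ∘ y₀ ≈ v₀
          y₀-over = assoc _ _ _ ∙ ∘-congˡ π₂-pair

          Y : Presheaf
          Y = free Y₀ v₀

          y : PshHom Y X′
          y = _♯ Y₀ v₀ X′ y₀ y₀-over

          y-η : arr y ∘ η Y₀ v₀ ≈ y₀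
          y-η = ♯-η Y₀ v₀ X′ y₀ y₀-over

          gen-y : gen W (X.π ∘ h) ∘ arr y ≈ (ν ∘ n₀) ∘ gen Y₀ v₀
          gen-y = gen-· W (X.π ∘ h) ∙ pullˡ π₁-pair

          -- Followed by the projection to `W`, `y` is a composite of `ν`, a pullback of `y₁` and a
          -- pullback of `cod`, all small.
          y-small : Small (arr y)
          y-small = small-cancel (gen W (X.π ∘ h)) (small-resp-≈ (Eq.sym gen-y)
            (composition (composition ν-small (pullback-stable Y₀-pullback y₁-small)) (small-π₁ v₀ cod-small)))

          q-y₀ : arr q ∘ y₀ ≈ (q₁ ∘ y₁) ∘ i₀
          q-y₀ = ♯-∘ W (X.π ∘ h) X h Eq.refl y₀ {Eq.sym (assoc _ _ _) ∙ extend (square (X.π ∘ h) cod)}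
            ∙ X.·-cong (∘-congˡ π₁-pair ∙ extend h-ν) π₂-pair
            ∙ Eq.sym (act-· X (μ ∘ n₀)) ∙ extend act-μ
            ∙ ∘-congˡ ξ-y₁ ∙ Eq.sym (assoc _ _ _)

          qy : PshHom Y X
          qy = composite {X′} {Y₀} {v₀} q y

          qy-η : arr qy ∘ η Y₀ v₀ ≈ (q₁ ∘ y₁) ∘ i₀
          qy-η = assoc _ _ _ ∙ ∘-congˡ y-η ∙ q-y₀

          P̂ : Presentation {Y₀} {Y₁} {v₀} {q₁ ∘ y₁} P₁ i₀ qy
          P̂ = presentation {Y₀} {Y₁} {v₀} {q₁ ∘ y₁} P₁ i₀ qy qy-η

          open Presentation P̂ using () renaming (mvs to P)

        module _ {Z : Presheaf} (ζ : PshHom Z X′) {qζ : PshHom Z X} (qζ≈ : arr qζ ≈ arr q ∘ arr ζ)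
                 (Q : MvsOver qζ) where
          private
            module Z = Presheaf Z

            w : Z.obj ⇒ W
            w = gen W (X.π ∘ h) ∘ arr ζ

            d : Z.obj ⇒ C₁
            d = arrow W (X.π ∘ h) ∘ arr ζ

            hd : Z.obj ⇒ X.π ×ₚ cod
            hd = pair X.π cod (h ∘ w) d (Eq.sym (assoc _ _ _) ∙ extend (square (X.π ∘ h) cod))

            act-hd : X.act ∘ hd ≈ arr qζ
            act-hd = Eq.sym (qζ≈ ∙ ♯-∘ W (X.π ∘ h) X h Eq.refl (arr ζ))

            pt : Z.obj ⇒ h ×ₚ X.elt
            pt = pair h X.elt w hd (Eq.sym π₁-pair)

            gap : N ⇒ h ×ₚ X.elt
            gap = pair h X.elt ν μ h-ν

            -- An element of `Z` lies over some `w · d`. As `gap` is a cover, an `n` in the family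
            -- of `w` with arrow `d` exists locally; `Z₁` consists of elements of `Z` with such a
            -- choice.
            Z₁ : Obj
            Z₁ = pt ×ₚ gap

            ζ₁ : Z₁ ⇒ Z.obj
            ζ₁ = π₁ pt gap

            n₁ : Z₁ ⇒ N
            n₁ = π₂ pt gap

            w-ζ₁ : w ∘ ζ₁ ≈ ν ∘ n₁
            w-ζ₁ = Eq.sym (pullˡ π₁-pair) ∙ ∘-congˡ (square pt gap) ∙ pullˡ π₁-pair

            hd-ζ₁ : hd ∘ ζ₁ ≈ μ ∘ n₁
            hd-ζ₁ = Eq.sym (pullˡ π₂-pair) ∙ ∘-congˡ (square pt gap) ∙ pullˡ π₂-pair

            d-ζ₁ : d ∘ ζ₁ ≈ X.mor ∘ (μ ∘ n₁)
            d-ζ₁ = Eq.sym (pullˡ π₂-pair) ∙ ∘-congˡ hd-ζ₁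

            z₁ : Z₁ ⇒ X₁
            z₁ = ξ ∘ n₁

            qζ-ζ₁ : arr qζ ∘ ζ₁ ≈ q₁ ∘ z₁
            qζ-ζ₁ = ∘-congʳ (Eq.sym act-hd) ∙ assoc _ _ _ ∙ ∘-congˡ hd-ζ₁ ∙ extend act-μ

            Q̂ : Translation {Z} {qζ} Q {Z₁} (q₁ ∘ z₁) ζ₁
            Q̂ = translation {Z} {qζ} Q {Z₁} {q₁ ∘ z₁} {ζ₁} qζ-ζ₁

            open Translation Q̂ using () renaming (mvs to Q₁)

            R : F.Refines φ̄ ᾱ q₁ y₁ P₁ z₁ Q₁
            R = generic₁ z₁ Q₁

            open F.Refines R using ()
              renaming (U to U₀; k to k₀; l to l₀; commute to y₁-k₀)

            ξ-n₁ : ξ ∘ (n₁ ∘ l₀) ≈ y₁ ∘ k₀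
            ξ-n₁ = Eq.sym (assoc _ _ _) ∙ Eq.sym y₁-k₀

            -- The chosen `n` and the index `k₀` supplied by fullness lie over the same point of
            -- `X₁`, so together they form a generator of `Y`.
            k₁ : U₀ ⇒ Y₀
            k₁ = ⟪ n₁ ∘ l₀ , k₀ ⟫[ ξ-n₁ ]

            n₀-k₁ : n₀ ∘ k₁ ≈ n₁ ∘ l₀
            n₀-k₁ = n₀-∘ (n₁ ∘ l₀) k₀ ξ-n₁

            i₀-k₁ : i₀ ∘ k₁ ≈ k₀
            i₀-k₁ = i₀-∘ (n₁ ∘ l₀) k₀ ξ-n₁

            y₀-k₁ : y₀ ∘ k₁ ≈ arr ζ ∘ (ζ₁ ∘ l₀)
            y₀-k₁ = joint-mono
              (pullˡ π₁-pair ∙ assoc _ _ _ ∙ ∘-congˡ n₀-k₁ ∙ extend (Eq.sym w-ζ₁) ∙ assoc _ _ _)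
              (pullˡ π₂-pair ∙ assoc _ _ _ ∙ ∘-congˡ (assoc _ _ _ ∙ ∘-congˡ n₀-k₁)
                ∙ ∘-congˡ (Eq.sym (assoc _ _ _)) ∙ Eq.sym (assoc _ _ _) ∙ ∘-congʳ (Eq.sym d-ζ₁)
                ∙ assoc _ _ _ ∙ assoc _ _ _)

          refines : RefinesOver {X′} {Y₀} {v₀} y {qy} P {Z} ζ {qζ} Q
          refines = refinement {X′} q {X₁} q₁ {Y₀} {Y₁} {v₀} {y₁} {P₁} {i₀} y {qy} Eq.refl P̂
            {Z} ζ {qζ} qζ≈ {Q} {Z₁} {z₁} {ζ₁} (cover-stable pt gap gap-cover) Q̂ R
            k₁ i₀-k₁ (pullˡ y-η ∙ y₀-k₁)

        genericMvs : PG.GenericMvs′ φ α β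
        genericMvs = assemble {X′} q q-cover {Y₀} {Y₁} {v₀} {q₁ ∘ y₁} {P₁} {i₀} y y-small P̂
          (λ {Z} ζ {qζ} qζ≈ Q → refines {Z} ζ {qζ} qζ≈ Q)

    fullness⇒genericMvs : F.Fullness → PG.GenericMvs′ φ α β
    fullness⇒genericMvs full =
      let J = full φ̄ ᾱ φ̄-small ᾱ-small
          open F.GenericMvs J using () renaming (q to q₁; q-cover to q₁-cover)
          -- Collection is applied to the small map `X.elt`, whose fibres consist of arrows, and to
          -- the cover by lifts to `X₁` of the restrictions along these arrows.
          _ , _ , z , _ , _ , ν-small , square-z =
            collection (π₁ X.act q₁) X.elt (cover-stable X.act q₁ q₁-cover) elt-small
      in genericMvs J z ν-small square-z

-- Fullness for presheaves.

-- A record rather than a synonym: its parameters are compared as they stand, whereas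
-- comparing the categories Psh built from them would unfold all their proofs.
record PresheavesFull {o ℓ e s} (𝓒 : Category o ℓ e) (pullback : HasPullbacks 𝓒)
                      (ℂ : InternalCategory 𝓒 pullback)
                      (Small : ∀ {A B} → Category._⇒_ 𝓒 A B → Set s) : Set (o ⊔ ℓ ⊔ e ⊔ s) where
  constructor presheavesFull
  field
    fullness : FullnessAxiom.Fullness (Presheaves.Psh 𝓒 pullback ℂ)
                 (Presheaves.Psh-pullbacks 𝓒 pullback ℂ)
                 (Presheaves.PointwiseSmall 𝓒 pullback ℂ Small)

module PresheafFullness {o ℓ e s} (𝓔 : PredicativeCategoryWithSmallMaps o ℓ e s)
         (ℂ : InternalCategory (PredicativeCategoryWithSmallMaps.category 𝓔)
                               (PredicativeCategoryWithSmallMaps.pullback 𝓔)) where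
  open PredicativeCategoryWithSmallMaps 𝓔
  open Presheaves category pullback ℂ
  open SmallLemmas 𝓔
  private
    module PG = Generalized Psh Psh-pullbacks (PointwiseSmall Small)
    module PF = FullnessAxiom Psh Psh-pullbacks (PointwiseSmall Small)

  module _ (full : FullnessAxiom.Fullness category pullback Small)
           (cod-small : Small (InternalCategory.cod ℂ)) where

    module _ {X A B : Presheaf} (φ : PshHom B A) (α : PshHom A X)
             (φ-small : Small (PshHom.arr φ)) (α-small : Small (PshHom.arr α)) where
      private
        αφ : PshHom B X
        αφ = Category._∘_ Psh α φ

        generic : PG.GenericMvs′ φ α αφ
        generic = GenericPresheafMvs.fullness⇒genericMvs 𝓔 ℂ cod-small {X} {A} {B} φ α αφ Eq.refl
          φ-small α-small full

      genericMvs : PF.GenericMvs φ α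
      genericMvs = PG.GenericMvs′⇒GenericMvs small-resp-≈ {X} {A} {B} {φ} {α} {αφ} refl generic

    fullness : PF.Fullness
    fullness = genericMvs

module _ where
  private
    module P = PredicativeCategoryWithSmallMaps

  -- The pullbacks are in the form to which the types in PresheafFullness reduce; the record
  -- PresheavesFull then mediates to the form used in theorem3p10.
  presheaves-full : ∀ {o ℓ e s} (𝓔 : PredicativeCategoryWithSmallMaps o ℓ e s) →
    let pullback : HasPullbacks (P.category 𝓔)
        pullback = PositiveHeyting.pullback (P.positiveHeyting 𝓔)
    in
    FullnessAxiom.Fullness (P.category 𝓔) pullback (P.Small 𝓔) →
    (ℂ : InternalCategory (P.category 𝓔) pullback) →
    P.Small 𝓔 (InternalCategory.cod ℂ) →
    PresheavesFull (P.category 𝓔) pullback ℂ (P.Small 𝓔)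
  presheaves-full {o} {ℓ} {e} {s} 𝓔 full ℂ cod-small =
    presheavesFull (PresheafFullness.fullness {o} {ℓ} {e} {s} 𝓔 ℂ full cod-small)

Psh-fullness : ∀ {o ℓ e s} (𝓔 : PredicativeCategoryWithSmallMaps o ℓ e s) →
    let open PredicativeCategoryWithSmallMaps 𝓔 in
    (ℂ : InternalCategory category pullback) →
    let open Presheaves category pullback ℂ in
    PresheavesFull category pullback ℂ Small →
    FullnessAxiom.Fullness Psh Psh-pullbacks (PointwiseSmall Small)
Psh-fullness 𝓔 ℂ (presheavesFull fullness) {X} {A} {B} = fullness {X} {A} {B}

theorem3p10 : ∀ {o ℓ e s} (𝓔 : PredicativeCategoryWithSmallMaps o ℓ e s) →
    let open PredicativeCategoryWithSmallMaps 𝓔 in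
    FullnessAxiom.Fullness category pullback Small →
    (ℂ : InternalCategory category pullback) →
    let open Presheaves category pullback ℂ in
    Small (InternalCategory.cod ℂ) →
    ChosenPullbacks ℂ →
    FullnessAxiom.Fullness Psh Psh-pullbacks (PointwiseSmall Small)
theorem3p10 {o} {ℓ} {e} {s} 𝓔 full ℂ cod-small _ {X} {A} {B} =
  Psh-fullness {o} {ℓ} {e} {s} 𝓔 ℂ (presheaves-full {o} {ℓ} {e} {s} 𝓔 full ℂ cod-small) {X} {A} {B}
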